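{- Let $(\mathcal{P},\mathcal{B})$ be an $\mathrm{SRPG}(s,t;\alpha_1,\dots,\alpha_r;\lambda,\mu)$ with $v=|\mathcal{P}|$ points and incidence matrix $M$, and let $C(M)$ be the binary linear code with parity-check matrix $M$. Put $k=s(t+1)$, $\Delta=(\lambda-\mu)^2+4(k-\mu)$ and $n=v(t+1)/(s+1)$ (the number of blocks). Then the minimum distance $d$ of $C(M)$ satisfies $$d\ \ge\ \max\left\{\frac{n\,(4s-2t+2-\lambda+\mu-\sqrt{\Delta})}{2s(t+1)-\lambda+\mu-\sqrt{\Delta}},\ \ \frac{2n\,(4s-\lambda+\mu-\sqrt{\Delta})}{(t+1)\,(2s(t+1)-\lambda+\mu-\sqrt{\Delta})}\right\}.$$
   Context: A generalized partial geometry of grade $r$, denoted $\mathrm{PG}(s,t;\alpha_1,\dots,\alpha_r)$, is an incidence structure $(\mathcal{P},\mathcal{B})$, with $\mathcal{P}$ a finite non-empty set of points and $\mathcal{B}$ a family of subsets of $\mathcal{P}$ (blocks), incidence being containment, such that: (i) any two distinct points are incident with at most one common block; (ii) each block is incident with exactly $s+1$ points; (iii) each point is incident with exactly $t+1$ blocks; (iv) for any point $P$ and block $B$ with $P\notin B$, there is $\alpha\in\{\alpha_1,\dots,\alpha_r\}$ such that exactly $\alpha$ points of $B$ are joined to $P$ (two points are joined if some block contains both); (v) for each $\alpha\in\{\alpha_1,\dots,\alpha_r\}$ there exist a point $P$ and a block $B$ with $P\notin B$ such that exactly $\alpha$ points of $B$ are joined to $P$. The point graph of $(\mathcal{P},\mathcal{B})$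 has vertex set $\mathcal{P}$, two distinct points being adjacent if and only if some block contains both. A $k$-regular graph on $v$ vertices is strongly regular with parameters $(v,k,\lambda,\mu)$ if any two adjacent vertices have exactly $\lambda$ common neighbours and any two distinct non-adjacent vertices have exactly $\mu$ common neighbours. A $\mathrm{PG}(s,t;\alpha_1,\dots,\alpha_r)$ whose point graph is strongly regular with parameters $(v,k,\lambda,\mu)$ is denoted $\mathrm{SRPG}(s,t;\alpha_1,\dots,\alpha_r;\lambda,\mu)$; its parameters are $k=s(t+1)$ and $v=\frac{k(k-\lambda-1)}{\mu}+k+1$ (so $\mu\neq0$). The incidence matrix $M$ is the $v\times n$ $0/1$ matrix with rows indexed by points and columns by blocks, with entry $1$ exactly when the point lies on the block. $C(M)=\{c\in\mathbb{F}_2^n: Mc^T=0\}$, and its minimum distance is the minimum Hamming weight of a nonzero codeword. -}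

module Defs where

open import Algebra.Bundles using (CommutativeRing)
import Algebra.Properties.CommutativeMonoid.Sum as Sum
open import Data.Bool.Base using (if_then_else_)
open import Data.Fin.Base using (Fin)
open import Data.Fin.Properties using (any?; _≟_)
open import Data.Fin.Subset using (Subset; _∈_; _∉_; ∣_∣)
open import Data.Fin.Subset.Properties using (_∈?_)
open import Data.Integer.Base as ℤ using (ℤ; +_; -[1+_])
import Data.Integer.Properties as ℤ
import Data.Integer.Solver as ℤSolver
open import Data.Nat.Base as ℕ using (ℕ; zero; suc)
import Data.Nat.Properties as ℕ
import Data.Nat.Solver as ℕSolver
open import Data.Parity.Base as ℙ using (Parity; 0ℙ; 1ℙ)
import Data.Parity.Properties as ℙ
open import Data.Product.Base using (∃; ∃₂; _×_; _,_; proj₁; proj₂)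
open import Data.Rational.Base as ℚ using (ℚ; mkℚ; 0ℚ; 1ℚ; ½)
import Data.Rational.Properties as ℚ
import Data.Rational.Solver as ℚSolver
open import Data.Rational.Unnormalised.Base as ℚᵘ using (mkℚᵘ)
import Data.Rational.Unnormalised.Properties as ℚᵘ
open import Data.Sum.Base using (inj₁; inj₂)
open import Data.Vec.Base using (allFin; count)
open import Data.Vec.Functional using (Vector)
open import Function.Definitions using (Injective)
open import Level using (0ℓ)
open import Relation.Binary using (Rel; Decidable; Symmetric; Irreflexive)
open import Relation.Binary.PropositionalEquality
  using (_≡_; _≢_; refl; sym; trans; cong; cong₂; subst)
open import Relation.Nullary using (¬_; yes; no; does; contradiction)
open import Relation.Nullary.Decidable using (_×-dec_; ¬?)
import Relation.Unary as U

-- Real numbers: Cauchy sequences of rationals.  All operations act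
-- termwise, so algebraic laws of ℚ hold termwise as well.

module CauchyLemmas where

  IsCauchy : (ℕ → ℚ) → Set
  IsCauchy x = ∀ ε → 0ℚ ℚ.< ε → ∃ λ N → ∀ m n → N ℕ.≤ m → N ℕ.≤ n →
               ℚ.∣ x m ℚ.- x n ∣ ℚ.≤ ε

  isqrt : ℕ → ℕ
  isqrt zero    = 0
  isqrt (suc n) with suc (isqrt n) ℕ.* suc (isqrt n) ℕ.≤? suc n
  ... | yes _ = suc (isqrt n)
  ... | no  _ = isqrt n

  isqrt-spec : ∀ n → isqrt n ℕ.* isqrt n ℕ.≤ n × n ℕ.< suc (isqrt n) ℕ.* suc (isqrt n)
  isqrt-spec zero = ℕ.z≤n , ℕ.s≤s ℕ.z≤n
  isqrt-spec (suc n) with isqrt-spec n | suc (isqrt n) ℕ.* suc (isqrt n) ℕ.≤? suc n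
  ... | _ , hi | yes p = p , ℕ.≤-<-trans hi
                         (ℕ.*-mono-< (ℕ.n<1+n (suc (isqrt n))) (ℕ.n<1+n (suc (isqrt n))))
  ... | lo , _ | no ¬p = ℕ.m≤n⇒m≤1+n lo , ℕ.≰⇒> ¬p

  square-cancel-< : ∀ {a b} → a ℕ.* a ℕ.< b ℕ.* b → a ℕ.< b
  square-cancel-< {a} {b} h with a ℕ.<? b
  ... | yes a<b = a<b
  ... | no  a≮b = contradiction h (ℕ.≤⇒≯ (ℕ.*-mono-≤ (ℕ.≮⇒≥ a≮b) (ℕ.≮⇒≥ a≮b)))

  root : ℕ → ℕ → ℕ
  root D n = isqrt (D ℕ.* (suc n ℕ.* suc n))

  root-cross : ∀ D m n → root D m ℕ.* suc n ℕ.< suc (root D n) ℕ.* suc m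
  root-cross D m n = square-cancel-< (begin-strict
    (a ℕ.* suc n) ℕ.* (a ℕ.* suc n)
      ≡⟨ solve 2 (λ a n → (a :* n) :* (a :* n) := (a :* a) :* (n :* n)) refl a (suc n) ⟩
    (a ℕ.* a) ℕ.* (suc n ℕ.* suc n)
      ≤⟨ ℕ.*-monoˡ-≤ (suc n ℕ.* suc n) (proj₁ (isqrt-spec (D ℕ.* (suc m ℕ.* suc m)))) ⟩
    (D ℕ.* (suc m ℕ.* suc m)) ℕ.* (suc n ℕ.* suc n)
      ≡⟨ solve 3 (λ D m n → (D :* (m :* m)) :* (n :* n) := (D :* (n :* n)) :* (m :* m))
           refl D (suc m) (suc n) ⟩
    (D ℕ.* (suc n ℕ.* suc n)) ℕ.* (suc m ℕ.* suc m)
      <⟨ ℕ.*-monoˡ-< (suc m ℕ.* suc m) (proj₂ (isqrt-spec (D ℕ.* (suc n ℕ.* suc n)))) ⟩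
    (b ℕ.* b) ℕ.* (suc m ℕ.* suc m)
      ≡⟨ solve 2 (λ b m → (b :* b) :* (m :* m) := (b :* m) :* (b :* m)) refl b (suc m) ⟩
    (b ℕ.* suc m) ℕ.* (b ℕ.* suc m) ∎)
    where
    open ℕ.≤-Reasoning
    open ℕSolver.+-*-Solver
    a = root D m
    b = suc (root D n)

  /-mono : ∀ a b m n → a ℕ.* suc n ℕ.≤ b ℕ.* suc m → + a ℚ./ suc m ℚ.≤ + b ℚ./ suc n
  /-mono a b m n h = ℚ.toℚᵘ-cancel-≤ (ℚᵘ.≤-respˡ-≃ (ℚᵘ.≃-sym (ℚ.toℚᵘ-fromℚᵘ (mkℚᵘ (+ a) m)))
    (ℚᵘ.≤-respʳ-≃ (ℚᵘ.≃-sym (ℚ.toℚᵘ-fromℚᵘ (mkℚᵘ (+ b) n)))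
      (ℚᵘ.*≤* (subst₂′ (ℤ.+≤+ h)))))
    where
    subst₂′ : + (a ℕ.* suc n) ℤ.≤ + (b ℕ.* suc m) → + a ℤ.* + suc n ℤ.≤ + b ℤ.* + suc m
    subst₂′ p rewrite ℤ.pos-* a (suc n) | ℤ.pos-* b (suc m) = p

  suc/ : ∀ a n → + suc a ℚ./ suc n ≡ + a ℚ./ suc n ℚ.+ + 1 ℚ./ suc n
  suc/ a n = ℚ.toℚᵘ-injective (ℚᵘ.≃-trans (ℚ.toℚᵘ-fromℚᵘ (mkℚᵘ (+ suc a) n))
    (ℚᵘ.≃-trans same (ℚᵘ.≃-sym (ℚᵘ.≃-trans
      (ℚ.toℚᵘ-homo-+ (+ a ℚ./ suc n) (+ 1 ℚ./ suc n))
      (ℚᵘ.+-cong (ℚ.toℚᵘ-fromℚᵘ (mkℚᵘ (+ a) n)) (ℚ.toℚᵘ-fromℚᵘ (mkℚᵘ (+ 1) n)))))))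
    where
    open ℤSolver.+-*-Solver
    same : mkℚᵘ (+ suc a) n ℚᵘ.≃ mkℚᵘ (+ a) n ℚᵘ.+ mkℚᵘ (+ 1) n
    same = ℚᵘ.*≡* (trans
      (cong ((+ suc a) ℤ.*_) (ℤ.pos-* (suc n) (suc n)))
      (solve 2 (λ a n → (con (+ 1) :+ a) :* (n :* n) := (a :* n :+ con (+ 1) :* n) :* n)
        refl (+ a) (+ suc n)))

  archimedean : ∀ ε → 0ℚ ℚ.< ε → ∃ λ N → + 1 ℚ./ suc N ℚ.≤ ε
  archimedean (mkℚ (+ zero) d c) (ℚ.*<* (ℤ.+<+ ()))
  archimedean ε@(mkℚ (+ suc a) d c) 0<ε = d ,
    subst (+ 1 ℚ./ suc d ℚ.≤_) (ℚ.↥p/↧p≡p ε)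
      (/-mono 1 (suc a) d d (ℕ.*-monoˡ-≤ (suc d) {1} {suc a} (ℕ.s≤s ℕ.z≤n)))
  archimedean (mkℚ -[1+ a ] d c) (ℚ.*<* ())

  open ℚSolver.+-*-Solver using (solve; _:=_; _:+_; _:-_; _:*_; :-_; con)

  *-pos : ∀ {p q} → 0ℚ ℚ.< p → 0ℚ ℚ.< q → 0ℚ ℚ.< p ℚ.* q
  *-pos {p} {q} 0<p 0<q = subst (ℚ._< p ℚ.* q) (ℚ.*-zeroʳ p)
    (ℚ.*-monoʳ-<-pos p {{ℚ.positive 0<p}} 0<q)

  half : ℚ → ℚ
  half ε = ½ ℚ.* ε

  half-pos : ∀ {ε} → 0ℚ ℚ.< ε → 0ℚ ℚ.< half ε
  half-pos = *-pos (ℚ.positive⁻¹ ½)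

  half+half : ∀ ε → half ε ℚ.+ half ε ≡ ε
  half+half ε = trans (sym (ℚ.*-distribʳ-+ ε ½ ½)) (ℚ.*-identityˡ ε)

  *-mono-≤ : ∀ {a b c d} → 0ℚ ℚ.≤ a → 0ℚ ℚ.≤ d → a ℚ.≤ b → c ℚ.≤ d →
             a ℚ.* c ℚ.≤ b ℚ.* d
  *-mono-≤ {a} {b} {c} {d} 0≤a 0≤d a≤b c≤d = ℚ.≤-trans
    (ℚ.*-monoˡ-≤-nonNeg a {{ℚ.nonNegative 0≤a}} c≤d)
    (ℚ.*-monoʳ-≤-nonNeg d {{ℚ.nonNegative 0≤d}} a≤b)

  ∣-∣≤⇒≤+ : ∀ {a b ε} → ℚ.∣ a ℚ.- b ∣ ℚ.≤ ε → a ℚ.≤ b ℚ.+ ε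
  ∣-∣≤⇒≤+ {a} {b} {ε} h = subst (ℚ._≤ b ℚ.+ ε)
    (solve 2 (λ a b → b :+ (a :- b) := a) refl a b)
    (ℚ.+-monoʳ-≤ b (ℚ.≤-trans (p≤∣p∣ (a ℚ.- b)) h))
    where
    p≤∣p∣ : ∀ p → p ℚ.≤ ℚ.∣ p ∣
    p≤∣p∣ p with ℚ.≤-total 0ℚ p
    ... | inj₁ 0≤p = ℚ.≤-reflexive (sym (ℚ.0≤p⇒∣p∣≡p 0≤p))
    ... | inj₂ p≤0 = ℚ.≤-trans p≤0 (ℚ.0≤∣p∣ p)

  ≤+⇒∣-∣≤ : ∀ {a b ε} → a ℚ.≤ b ℚ.+ ε → b ℚ.≤ a ℚ.+ ε → ℚ.∣ a ℚ.- b ∣ ℚ.≤ ε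
  ≤+⇒∣-∣≤ {a} {b} {ε} h k with ℚ.∣p∣≡p∨∣p∣≡-p (a ℚ.- b)
  ... | inj₁ e = subst (ℚ._≤ ε) (sym e) (subst ((a ℚ.- b) ℚ.≤_)
          (solve 2 (λ b ε → b :+ ε :- b := ε) refl b ε)
          (ℚ.+-monoˡ-≤ (ℚ.- b) h))
  ... | inj₂ e = subst (ℚ._≤ ε) (trans
          (solve 2 (λ a b → b :- a := :- (a :- b)) refl a b) (sym e))
          (subst ((b ℚ.- a) ℚ.≤_) (solve 2 (λ a ε → a :+ ε :- a := ε) refl a ε)
          (ℚ.+-monoˡ-≤ (ℚ.- a) k))

  bounded : ∀ {x} → IsCauchy x →
            ∃ λ B → 0ℚ ℚ.< B × ∃ λ N → ∀ n → N ℕ.≤ n → ℚ.∣ x n ∣ ℚ.≤ B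
  bounded {x} cx with cx 1ℚ (ℚ.positive⁻¹ 1ℚ)
  ... | N , h = ℚ.∣ x N ∣ ℚ.+ 1ℚ
              , ℚ.+-mono-≤-< (ℚ.0≤∣p∣ (x N)) (ℚ.positive⁻¹ 1ℚ)
              , N , λ n N≤n → ℚ.≤-trans
                  (subst (λ z → ℚ.∣ z ∣ ℚ.≤ ℚ.∣ x N ∣ ℚ.+ ℚ.∣ x n ℚ.- x N ∣)
                    (solve 2 (λ a b → a :+ (b :- a) := b) refl (x N) (x n))
                    (ℚ.∣p+q∣≤∣p∣+∣q∣ (x N) (x n ℚ.- x N)))
                  (ℚ.+-monoʳ-≤ ℚ.∣ x N ∣ (h n N N≤n ℕ.≤-refl))

  const-cauchy : ∀ q → IsCauchy (λ _ → q)
  const-cauchy q ε 0<ε = 0 , λ _ _ _ _ →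
    subst (λ z → ℚ.∣ z ∣ ℚ.≤ ε) (sym (ℚ.+-inverseʳ q)) (ℚ.<⇒≤ 0<ε)

  ∸-cauchy : ∀ {x y} → IsCauchy x → IsCauchy y → IsCauchy (λ n → x n ℚ.- y n)
  ∸-cauchy {x} {y} cx cy ε 0<ε
    with cx (half ε) (half-pos 0<ε) | cy (half ε) (half-pos 0<ε)
  ... | M , h | N , k = M ℕ.⊔ N , λ m n p q → ℚ.≤-trans
    (subst (λ z → ℚ.∣ z ∣ ℚ.≤ ℚ.∣ x m ℚ.- x n ∣ ℚ.+ ℚ.∣ y m ℚ.- y n ∣)
      (solve 4 (λ a b c d → (a :- b) :- (c :- d) := (a :- c) :- (b :- d)) refl
        (x m) (x n) (y m) (y n))
      (ℚ.∣p-q∣≤∣p∣+∣q∣ (x m ℚ.- x n) (y m ℚ.- y n)))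
    (subst (ℚ.∣ x m ℚ.- x n ∣ ℚ.+ ℚ.∣ y m ℚ.- y n ∣ ℚ.≤_) (half+half ε)
      (ℚ.+-mono-≤ (h m n (ℕ.m⊔n≤o⇒m≤o M N p) (ℕ.m⊔n≤o⇒m≤o M N q))
                  (k m n (ℕ.m⊔n≤o⇒n≤o M N p) (ℕ.m⊔n≤o⇒n≤o M N q))))

  *-step : ∀ {a b c d A D δ} → 0ℚ ℚ.≤ D → 0ℚ ℚ.≤ δ →
           ℚ.∣ a ∣ ℚ.≤ A → ℚ.∣ c ℚ.- d ∣ ℚ.≤ δ → ℚ.∣ a ℚ.- b ∣ ℚ.≤ δ → ℚ.∣ d ∣ ℚ.≤ D →
           ℚ.∣ a ℚ.* c ℚ.- b ℚ.* d ∣ ℚ.≤ A ℚ.* δ ℚ.+ δ ℚ.* D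
  *-step {a} {b} {c} {d} {A} {D} {δ} 0≤D 0≤δ a≤A c-d≤δ a-b≤δ d≤D = begin
    ℚ.∣ a ℚ.* c ℚ.- b ℚ.* d ∣
      ≡⟨ cong ℚ.∣_∣ (solve 4 (λ a b c d → a :* c :- b :* d
                                 := a :* (c :- d) :+ (a :- b) :* d) refl a b c d) ⟩
    ℚ.∣ a ℚ.* (c ℚ.- d) ℚ.+ (a ℚ.- b) ℚ.* d ∣
      ≤⟨ ℚ.∣p+q∣≤∣p∣+∣q∣ (a ℚ.* (c ℚ.- d)) ((a ℚ.- b) ℚ.* d) ⟩
    ℚ.∣ a ℚ.* (c ℚ.- d) ∣ ℚ.+ ℚ.∣ (a ℚ.- b) ℚ.* d ∣
      ≡⟨ cong₂ ℚ._+_ (ℚ.∣p*q∣≡∣p∣*∣q∣ a (c ℚ.- d)) (ℚ.∣p*q∣≡∣p∣*∣q∣ (a ℚ.- b) d) ⟩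
    ℚ.∣ a ∣ ℚ.* ℚ.∣ c ℚ.- d ∣ ℚ.+ ℚ.∣ a ℚ.- b ∣ ℚ.* ℚ.∣ d ∣
      ≤⟨ ℚ.+-mono-≤ (*-mono-≤ (ℚ.0≤∣p∣ a) 0≤δ a≤A c-d≤δ)
                    (*-mono-≤ (ℚ.0≤∣p∣ (a ℚ.- b)) 0≤D a-b≤δ d≤D) ⟩
    A ℚ.* δ ℚ.+ δ ℚ.* D ∎
    where open ℚ.≤-Reasoning

  *-modulus : ∀ A D ε → 0ℚ ℚ.< A → 0ℚ ℚ.< D → 0ℚ ℚ.< ε →
              ∃ λ δ → 0ℚ ℚ.< δ × A ℚ.* δ ℚ.+ δ ℚ.* D ≡ ε
  *-modulus A D ε 0<A 0<D 0<ε = ε ℚ.* ℚ.1/ B , *-pos 0<ε 0<1/B ,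
    trans (solve 4 (λ a b e i → a :* (e :* i) :+ (e :* i) :* b := e :* (i :* (a :+ b)))
            refl A D ε (ℚ.1/ B))
          (trans (cong (ε ℚ.*_) (ℚ.*-inverseˡ B)) (ℚ.*-identityʳ ε))
    where
    B = A ℚ.+ D
    instance
      B-pos : ℚ.Positive B
      B-pos = ℚ.positive (ℚ.+-mono-< 0<A 0<D)
      B-nonZero : ℚ.NonZero B
      B-nonZero = ℚ.pos⇒nonZero B
    0<1/B : 0ℚ ℚ.< ℚ.1/ B
    0<1/B = ℚ.positive⁻¹ (ℚ.1/ B) {{ℚ.1/pos⇒pos B}}

  *-cauchy : ∀ {x y} → IsCauchy x → IsCauchy y → IsCauchy (λ n → x n ℚ.* y n)
  *-cauchy {x} {y} cx cy ε 0<ε =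
    let A , 0<A , K , bx = bounded cx
        D , 0<D , L , by = bounded cy
        δ , 0<δ , eq     = *-modulus A D ε 0<A 0<D 0<ε
        M , h            = cx δ 0<δ
        N , k            = cy δ 0<δ
    in combine A D δ (ℚ.<⇒≤ 0<D) (ℚ.<⇒≤ 0<δ) eq K L M N bx by h k
    where
    combine : ∀ A D δ → 0ℚ ℚ.≤ D → 0ℚ ℚ.≤ δ → A ℚ.* δ ℚ.+ δ ℚ.* D ≡ ε → ∀ K L M N →
              (∀ n → K ℕ.≤ n → ℚ.∣ x n ∣ ℚ.≤ A) → (∀ n → L ℕ.≤ n → ℚ.∣ y n ∣ ℚ.≤ D) →
              (∀ m n → M ℕ.≤ m → M ℕ.≤ n → ℚ.∣ x m ℚ.- x n ∣ ℚ.≤ δ) →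
              (∀ m n → N ℕ.≤ m → N ℕ.≤ n → ℚ.∣ y m ℚ.- y n ∣ ℚ.≤ δ) →
              ∃ λ T → ∀ m n → T ℕ.≤ m → T ℕ.≤ n →
              ℚ.∣ x m ℚ.* y m ℚ.- x n ℚ.* y n ∣ ℚ.≤ ε
    combine A D δ 0≤D 0≤δ eq K L M N bx by h k = (M ℕ.⊔ N) ℕ.⊔ (K ℕ.⊔ L) , λ m n p q →
      let p₁ = ℕ.m⊔n≤o⇒m≤o (M ℕ.⊔ N) (K ℕ.⊔ L) p
          p₂ = ℕ.m⊔n≤o⇒n≤o (M ℕ.⊔ N) (K ℕ.⊔ L) p
          q₁ = ℕ.m⊔n≤o⇒m≤o (M ℕ.⊔ N) (K ℕ.⊔ L) q
          q₂ = ℕ.m⊔n≤o⇒n≤o (M ℕ.⊔ N) (K ℕ.⊔ L) q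
      in subst (ℚ.∣ x m ℚ.* y m ℚ.- x n ℚ.* y n ∣ ℚ.≤_) eq
           (*-step {x m} {x n} {y m} {y n} {A} {D} {δ} 0≤D 0≤δ
             (bx m (ℕ.m⊔n≤o⇒m≤o K L p₂))
             (k m n (ℕ.m⊔n≤o⇒n≤o M N p₁) (ℕ.m⊔n≤o⇒n≤o M N q₁))
             (h m n (ℕ.m⊔n≤o⇒m≤o M N p₁) (ℕ.m⊔n≤o⇒m≤o M N q₁))
             (by n (ℕ.m⊔n≤o⇒n≤o K L q₂)))

  ⊔-cauchy : ∀ {x y} → IsCauchy x → IsCauchy y → IsCauchy (λ n → x n ℚ.⊔ y n)
  ⊔-cauchy {x} {y} cx cy ε 0<ε with cx ε 0<ε | cy ε 0<ε
  ... | M , h | N , k = M ℕ.⊔ N , λ m n p q →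
    ≤+⇒∣-∣≤ (step m n p q) (step n m q p)
    where
    step : ∀ m n → M ℕ.⊔ N ℕ.≤ m → M ℕ.⊔ N ℕ.≤ n →
           x m ℚ.⊔ y m ℚ.≤ x n ℚ.⊔ y n ℚ.+ ε
    step m n p q = ℚ.⊔-lub
      (ℚ.≤-trans (∣-∣≤⇒≤+ {x m} {x n} (h m n (ℕ.m⊔n≤o⇒m≤o M N p) (ℕ.m⊔n≤o⇒m≤o M N q)))
                 (ℚ.+-monoˡ-≤ ε (ℚ.p≤p⊔q (x n) (y n))))
      (ℚ.≤-trans (∣-∣≤⇒≤+ {y m} {y n} (k m n (ℕ.m⊔n≤o⇒n≤o M N p) (ℕ.m⊔n≤o⇒n≤o M N q)))
                 (ℚ.+-monoˡ-≤ ε (ℚ.p≤q⊔p (x n) (y n))))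

  inv : ℚ → ℚ
  inv q with q ℚ.≟ 0ℚ
  ... | yes _  = 0ℚ
  ... | no q≢0 = ℚ.1/_ q {{ℚ.≢-nonZero q≢0}}

  *-inv : ∀ {q} → q ≢ 0ℚ → q ℚ.* inv q ≡ 1ℚ
  *-inv {q} q≢0 with q ℚ.≟ 0ℚ
  ... | yes q≡0 = contradiction q≡0 q≢0
  ... | no q≢0′ = ℚ.*-inverseʳ q {{ℚ.≢-nonZero q≢0′}}

  inv-bound : ∀ {q η} .{{_ : ℚ.Positive η}} → η ℚ.≤ ℚ.∣ q ∣ → q ≢ 0ℚ →
              ℚ.∣ inv q ∣ ℚ.* η ℚ.≤ 1ℚ
  inv-bound {q} {η} η≤q q≢0 = begin
    ℚ.∣ inv q ∣ ℚ.* η        ≤⟨ ℚ.*-monoˡ-≤-nonNeg ℚ.∣ inv q ∣ {{ℚ.∣-∣-nonNeg (inv q)}} η≤q ⟩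
    ℚ.∣ inv q ∣ ℚ.* ℚ.∣ q ∣  ≡⟨ ℚ.∣p*q∣≡∣p∣*∣q∣ (inv q) q ⟨
    ℚ.∣ inv q ℚ.* q ∣        ≡⟨ cong ℚ.∣_∣ (trans (ℚ.*-comm (inv q) q) (*-inv q≢0)) ⟩
    1ℚ                       ∎
    where open ℚ.≤-Reasoning

  inv-diff : ∀ {a b} → a ≢ 0ℚ → b ≢ 0ℚ →
             inv a ℚ.- inv b ≡ (b ℚ.- a) ℚ.* (inv a ℚ.* inv b)
  inv-diff {a} {b} a≢0 b≢0 = sym (trans
    (solve 4 (λ a b c d → (b :- a) :* (c :* d) := c :* (b :* d) :- (a :* c) :* d)
      refl a b (inv a) (inv b))
    (cong₂ ℚ._-_
      (trans (cong (inv a ℚ.*_) (*-inv b≢0)) (ℚ.*-identityʳ (inv a)))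
      (trans (cong (ℚ._* inv b) (*-inv a≢0)) (ℚ.*-identityˡ (inv b)))))

  inv-step : ∀ {a b η ε} .{{_ : ℚ.Positive η}} → 0ℚ ℚ.≤ ε → a ≢ 0ℚ → b ≢ 0ℚ →
             η ℚ.≤ ℚ.∣ a ∣ → η ℚ.≤ ℚ.∣ b ∣ → ℚ.∣ b ℚ.- a ∣ ℚ.≤ ε ℚ.* (η ℚ.* η) →
             ℚ.∣ inv a ℚ.- inv b ∣ ℚ.≤ ε
  inv-step {a} {b} {η} {ε} 0≤ε a≢0 b≢0 ha hb h = begin
    ℚ.∣ inv a ℚ.- inv b ∣
      ≡⟨ cong ℚ.∣_∣ (inv-diff a≢0 b≢0) ⟩
    ℚ.∣ (b ℚ.- a) ℚ.* (inv a ℚ.* inv b) ∣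
      ≡⟨ trans (ℚ.∣p*q∣≡∣p∣*∣q∣ (b ℚ.- a) _)
               (cong (ℚ.∣ b ℚ.- a ∣ ℚ.*_) (ℚ.∣p*q∣≡∣p∣*∣q∣ (inv a) (inv b))) ⟩
    ℚ.∣ b ℚ.- a ∣ ℚ.* (u ℚ.* w)
      ≤⟨ ℚ.*-monoʳ-≤-nonNeg (u ℚ.* w) {{ℚ.nonNegative 0≤uw}} h ⟩
    (ε ℚ.* (η ℚ.* η)) ℚ.* (u ℚ.* w)
      ≡⟨ solve 4 (λ e h u w → (e :* (h :* h)) :* (u :* w) := e :* ((u :* h) :* (w :* h)))
           refl ε η u w ⟩
    ε ℚ.* ((u ℚ.* η) ℚ.* (w ℚ.* η))
      ≤⟨ ℚ.*-monoˡ-≤-nonNeg ε {{ℚ.nonNegative 0≤ε}}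
           (*-mono-≤ 0≤uη (ℚ.<⇒≤ (ℚ.positive⁻¹ 1ℚ)) (inv-bound ha a≢0) (inv-bound hb b≢0)) ⟩
    ε ℚ.* (1ℚ ℚ.* 1ℚ)
      ≡⟨ ℚ.*-identityʳ ε ⟩
    ε ∎
    where
    open ℚ.≤-Reasoning
    u = ℚ.∣ inv a ∣
    w = ℚ.∣ inv b ∣
    *-nonNeg : ∀ {p q} → 0ℚ ℚ.≤ p → 0ℚ ℚ.≤ q → 0ℚ ℚ.≤ p ℚ.* q
    *-nonNeg {p} {q} 0≤p 0≤q = subst (ℚ._≤ p ℚ.* q) (ℚ.*-zeroʳ p)
      (ℚ.*-monoˡ-≤-nonNeg p {{ℚ.nonNegative 0≤p}} 0≤q)
    0≤uw : 0ℚ ℚ.≤ u ℚ.* w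
    0≤uw = *-nonNeg (ℚ.0≤∣p∣ (inv a)) (ℚ.0≤∣p∣ (inv b))
    0≤uη : 0ℚ ℚ.≤ u ℚ.* η
    0≤uη = *-nonNeg (ℚ.0≤∣p∣ (inv a)) (ℚ.<⇒≤ (ℚ.positive⁻¹ η))

  inv-cauchy : ∀ {x} → IsCauchy x →
               (∃ λ η → 0ℚ ℚ.< η × ∃ λ N → ∀ n → N ℕ.≤ n → η ℚ.≤ ℚ.∣ x n ∣) →
               IsCauchy (λ n → inv (x n))
  inv-cauchy {x} cx (η , 0<η , N , b) ε 0<ε
    with cx (ε ℚ.* (η ℚ.* η)) (*-pos 0<ε (*-pos 0<η 0<η))
  ... | M , h = M ℕ.⊔ N , λ m n p q →
    let pN = ℕ.m⊔n≤o⇒n≤o M N p ; qN = ℕ.m⊔n≤o⇒n≤o M N q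
    in inv-step {x m} {x n} {η} {ε} {{ℚ.positive 0<η}} (ℚ.<⇒≤ 0<ε) (nz m pN) (nz n qN) (b m pN) (b n qN)
         (h n m (ℕ.m⊔n≤o⇒m≤o M N q) (ℕ.m⊔n≤o⇒m≤o M N p))
    where
    nz : ∀ n → N ℕ.≤ n → x n ≢ 0ℚ
    nz n h e = ℚ.<-irrefl refl
      (ℚ.<-≤-trans 0<η (subst (λ z → η ℚ.≤ ℚ.∣ z ∣) e (b n h)))

  √-cauchy : ∀ D → IsCauchy (λ n → + root D n ℚ./ suc n)
  √-cauchy D ε 0<ε with archimedean ε 0<ε
  ... | N , 1/N≤ε = N , λ m n p q → ≤+⇒∣-∣≤ (step m n q) (step n m p)
    where
    step : ∀ m n → N ℕ.≤ n →
           + root D m ℚ./ suc m ℚ.≤ + root D n ℚ./ suc n ℚ.+ ε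
    step m n N≤n = ℚ.≤-trans
      (/-mono (root D m) (suc (root D n)) m n (ℕ.<⇒≤ (root-cross D m n)))
      (subst (ℚ._≤ + root D n ℚ./ suc n ℚ.+ ε) (sym (suc/ (root D n) n))
        (ℚ.+-monoʳ-≤ (+ root D n ℚ./ suc n) (ℚ.≤-trans
          (/-mono 1 1 n N (ℕ.*-monoʳ-≤ 1 {suc N} {suc n} (ℕ.s≤s N≤n))) 1/N≤ε)))

module Real where

  open CauchyLemmas

  record ℝ : Set where
    constructor mkℝ
    field
      seq    : ℕ → ℚ
      cauchy : IsCauchy seq

  open ℝ public

  infix 4 _≤_ _#0

  _≤_ : Rel ℝ 0ℓ
  x ≤ y = ∀ ε → 0ℚ ℚ.< ε → ∃ λ N → ∀ n → N ℕ.≤ n → seq x n ℚ.≤ seq y n ℚ.+ ε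

  -- Constructive form of x ≠ 0 (apartness from 0), as required for x⁻¹.
  _#0 : ℝ → Set
  x #0 = ∃ λ η → 0ℚ ℚ.< η × ∃ λ N → ∀ n → N ℕ.≤ n → η ℚ.≤ ℚ.∣ seq x n ∣

  infixl 7 _*_
  infixl 6 _-_ _⊔_

  fromℤ : ℤ → ℝ
  fromℤ i = mkℝ (λ _ → i ℚ./ 1) (const-cauchy (i ℚ./ 1))

  fromℕ : ℕ → ℝ
  fromℕ n = fromℤ (+ n)

  _-_ : ℝ → ℝ → ℝ
  x - y = mkℝ (λ n → seq x n ℚ.- seq y n) (∸-cauchy {seq x} {seq y} (cauchy x) (cauchy y))

  _*_ : ℝ → ℝ → ℝ
  x * y = mkℝ (λ n → seq x n ℚ.* seq y n) (*-cauchy {seq x} {seq y} (cauchy x) (cauchy y))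

  _⊔_ : ℝ → ℝ → ℝ
  x ⊔ y = mkℝ (λ n → seq x n ℚ.⊔ seq y n) (⊔-cauchy {seq x} {seq y} (cauchy x) (cauchy y))

  infixl 7 _÷_[_]

  -- The real number does not depend on the proof that y is nonzero.
  _÷_[_] : ℝ → (y : ℝ) → y #0 → ℝ
  x ÷ y [ y#0 ] = x * mkℝ (λ n → inv (seq y n)) (inv-cauchy {seq y} (cauchy y) y#0)

  -- n-th approximation ⌊ (n+1)√D ⌋ / (n+1); the junk value 0 for negative
  -- integers is irrelevant: Δ < 0 forces s = 0, one point, and a zero code.
  √ : ℤ → ℝ
  √ (+ D)    = mkℝ (λ n → + root D n ℚ./ suc n) (√-cauchy D)
  √ -[1+ _ ] = fromℤ (+ 0)

#_ : ∀ {n} {P : U.Pred (Fin n) 0ℓ} → U.Decidable P → ℕ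
# P? = count P? (allFin _)

record IncidenceStructure (v n : ℕ) : Set where
  field
    nonEmpty  : v ≢ 0
    block     : Fin n → Subset v
    -- the blocks form a set of subsets: no repeated blocks
    injective : Injective _≡_ _≡_ block

  Joined : Rel (Fin v) 0ℓ
  Joined p q = ∃ λ j → p ∈ block j × q ∈ block j

  joined? : Decidable Joined
  joined? p q = any? λ j → (p ∈? block j) ×-dec (q ∈? block j)

  joinedIn : Fin v → Fin n → ℕ
  joinedIn p j = # λ q → (q ∈? block j) ×-dec joined? p q

record IsPG {v n r} (S : IncidenceStructure v n) (s t : ℕ) (α : Fin r → ℕ) : Set where
  open IncidenceStructure S
  field
    atMostOneBlock : ∀ {p q} → p ≢ q → ∀ {i j} →
                     p ∈ block i → q ∈ block i → p ∈ block j → q ∈ block j → i ≡ j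
    blockSize      : ∀ j → ∣ block j ∣ ≡ s ℕ.+ 1
    pointDegree    : ∀ p → # (λ j → p ∈? block j) ≡ t ℕ.+ 1
    antiflag       : ∀ p j → p ∉ block j → ∃ λ i → joinedIn p j ≡ α i
    attained       : ∀ i → ∃₂ λ p j → p ∉ block j × joinedIn p j ≡ α i

record Graph (v : ℕ) : Set₁ where
  field
    _~_    : Rel (Fin v) 0ℓ
    _~?_   : Decidable _~_
    sym~   : Symmetric _~_
    irrefl : Irreflexive _≡_ _~_

  degree : Fin v → ℕ
  degree x = # (x ~?_)

  commonNeighbours : Fin v → Fin v → ℕ
  commonNeighbours x y = # λ z → (x ~? z) ×-dec (y ~? z)

pointGraph : ∀ {v n} → IncidenceStructure v n → Graph v
pointGraph S = record
  { _~_    = λ p q → p ≢ q × Joined p q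
  ; _~?_   = λ p q → ¬? (p ≟ q) ×-dec joined? p q
  ; sym~   = λ { (p≢q , j , p∈j , q∈j) → (λ q≡p → p≢q (sym q≡p)) , j , q∈j , p∈j }
  ; irrefl = λ { p≡q (p≢q , _) → p≢q p≡q }
  }
  where open IncidenceStructure S

record IsStronglyRegular {v} (G : Graph v) (k ƛ μ : ℕ) : Set where
  open Graph G
  field
    regular     : ∀ x → degree x ≡ k
    adjacent    : ∀ {x y} → x ~ y → commonNeighbours x y ≡ ƛ
    nonAdjacent : ∀ {x y} → x ≢ y → ¬ x ~ y → commonNeighbours x y ≡ μ

-- With μ ≠ 0 the identity v = k(k-ƛ-1)/μ + k + 1 follows by counting paths
-- of length two from a vertex, so it is not a separate field.
record IsSRPG {v n r} (S : IncidenceStructure v n)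
              (s t : ℕ) (α : Fin r → ℕ) (ƛ μ : ℕ) : Set where
  field
    isPG              : IsPG S s t α
    isStronglyRegular : IsStronglyRegular (pointGraph S) (s ℕ.* (t ℕ.+ 1)) ƛ μ
    μ≢0               : μ ≢ 0

-- Binary words are vectors over Parity, the field with two elements.

open Sum (CommutativeRing.+-commutativeMonoid ℙ.+-*-commutativeRing) using (sum)

Matrix : ℕ → ℕ → Set
Matrix v n = Fin v → Fin n → Parity

incidenceMatrix : ∀ {v n} → IncidenceStructure v n → Matrix v n
incidenceMatrix S p j = if does (p ∈? block j) then 1ℙ else 0ℙ
  where open IncidenceStructure S

C : ∀ {v n} → Matrix v n → U.Pred (Vector Parity n) 0ℓ
C M c = ∀ i → sum (λ j → M i j ℙ.* c j) ≡ 0ℙ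

weight : ∀ {n} → Vector Parity n → ℕ
weight c = # λ j → c j ℙ.≟ 1ℙ

NonZeroWord : ∀ {n} → U.Pred (Vector Parity n) 0ℓ
NonZeroWord c = ¬ (∀ j → c j ≡ 0ℙ)

-- The zero code has no minimum distance.
IsMinimumDistance : ∀ {n} → U.Pred (Vector Parity n) 0ℓ → ℕ → Set
IsMinimumDistance K d =
  (∃ λ c → K c × NonZeroWord c × weight c ≡ d) ×
  (∀ c → K c → NonZeroWord c → d ℕ.≤ weight c)

{-# OPTIONS --safe #-}
module Submission where

-- Let A be the adjacency matrix of the point graph.  Then M Mᵀ = A + (t + 1) I,
-- and strong regularity reads A² = k I + ƛ A + μ (J - I - A), so on the vectors
-- orthogonal to the all-one vector A is bounded by θ = (ƛ - μ + √Δ) / 2.  A word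
-- c of weight d meets every point an even number of times.
--  * Let y = M c.  Since yₚ ≥ 2 wherever yₚ ≠ 0, ‖y‖² ≥ 2 ∑ y = 2 (s + 1) d,
--    while ‖M c‖² is bounded above through θ: this gives the first bound.
--  * Let z be the indicator of the set of m points met by c.  Each of them lies
--    on two blocks of c, so ⟨z , A z⟩ ≥ 2 s m, which together with θ bounds m
--    from below; finally 2 m ≤ (s + 1) d.
-- Square roots are avoided by working with (2 ⟨x , A x⟩ - (ƛ - μ) ‖x‖²)² ≤ Δ ‖x‖⁴
-- over ℤ and with the rational lower approximations ρ / L of √Δ.

open import Algebra.Bundles using (CommutativeRing)
import Algebra.Properties.CommutativeMonoid.Sum as CommutativeMonoidSum
import Algebra.Properties.Semiring.Sum as SemiringSum
open import Data.Bool.Base using (true; false; if_then_else_)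
open import Data.Fin.Base using (Fin; zero; suc)
open import Data.Fin.Properties using (_≟_)
open import Data.Fin.Subset using (Subset; inside; outside; ∣_∣; _∈_)
open import Data.Fin.Subset.Properties using (_∈?_; ⊆-antisym)
open import Data.Integer.Base as ℤ using (ℤ; +_; -[1+_]; 0ℤ; 1ℤ)
import Data.Integer.Properties as ℤ
open import Data.Integer.Tactic.RingSolver using (solve-∀)
open import Data.Nat.Base as ℕ using (ℕ; zero; suc; parity)
import Data.Nat.Properties as ℕ
open import Data.Parity.Base as ℙ using (Parity; 0ℙ; 1ℙ)
import Data.Parity.Properties as ℙ
open import Data.Product.Base using (∃; _×_; _,_; proj₁; proj₂; Σ-syntax)
open import Data.Rational.Base as ℚ using (ℚ; 0ℚ; 1ℚ)
import Data.Rational.Properties as ℚ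
import Data.Rational.Solver as ℚSolver
open import Data.Rational.Unnormalised.Base as ℚᵘ using (mkℚᵘ)
import Data.Rational.Unnormalised.Properties as ℚᵘ
open import Data.Sum.Base using (_⊎_; inj₁; inj₂)
open import Data.Vec.Base using ([]; _∷_; tabulate; count)
open import Data.Vec.Functional using (Vector)
open import Function.Base using (_∘_; id)
open import Relation.Binary.PropositionalEquality
  using (_≡_; _≢_; refl; sym; trans; cong; cong₂; subst; subst₂; module ≡-Reasoning)
open import Relation.Nullary using (¬_; Dec; yes; no; does; contradiction)
open import Relation.Nullary.Decidable using (_×-dec_; ¬?)
import Relation.Unary as U
open import Defs

module Sum = SemiringSum ℤ.+-*-semiring
open CommutativeMonoidSum (CommutativeRing.+-commutativeMonoid ℙ.+-*-commutativeRing)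
  using () renaming (sum to sumℙ)

-- Ordered arithmetic in ℤ, finite sums and inner products.

module LinearAlgebra where

  open import Data.Integer.Base using (_+_; _*_; _-_; -_; _≤_; _<_)

  -- The standard device for polynomial inequalities below: a ring identity, usually called
  -- `certificate`, rewrites the difference of the two sides as a combination `e` of quantities
  -- already known to be nonnegative.
  ≤-by : ∀ {x y e} → 0ℤ ≤ e → y - x ≡ e → x ≤ y
  ≤-by 0≤e eq = ℤ.0≤i-j⇒j≤i (subst (0ℤ ≤_) (sym eq) 0≤e)

  +-nonNeg : ∀ {x y} → 0ℤ ≤ x → 0ℤ ≤ y → 0ℤ ≤ x + y
  +-nonNeg = ℤ.+-mono-≤

  *-nonNeg : ∀ {x y} → 0ℤ ≤ x → 0ℤ ≤ y → 0ℤ ≤ x * y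
  *-nonNeg {x} 0≤x 0≤y =
    subst (_≤ x * _) (ℤ.*-zeroʳ x) (ℤ.*-monoˡ-≤-nonNeg x {{ℤ.nonNegative 0≤x}} 0≤y)

  *-pos : ∀ {x y} → 0ℤ < x → 0ℤ < y → 0ℤ < x * y
  *-pos {x} 0<x 0<y =
    subst (_< x * _) (ℤ.*-zeroʳ x) (ℤ.*-monoˡ-<-pos x {{ℤ.positive 0<x}} 0<y)

  *-cancelˡ-≤ : ∀ {x y z} → 0ℤ < z → z * x ≤ z * y → x ≤ y
  *-cancelˡ-≤ {x} {y} {z} 0<z = ℤ.*-cancelˡ-≤-pos x y z {{ℤ.positive 0<z}}

  square-nonNeg : ∀ x → 0ℤ ≤ x * x
  square-nonNeg x with ℤ.≤-total 0ℤ x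
  ... | inj₁ 0≤x = *-nonNeg 0≤x 0≤x
  ... | inj₂ x≤0 = subst (0ℤ ≤_) (neg-square x) (*-nonNeg 0≤-x 0≤-x)
    where
    0≤-x = ℤ.neg-mono-≤ x≤0
    neg-square : ∀ x → (- x) * (- x) ≡ x * x
    neg-square = solve-∀

  square-cancel-≤ : ∀ {x y} → 0ℤ ≤ y → x * x ≤ y * y → x ≤ y
  square-cancel-≤ {x} {y} 0≤y h with x ℤ.≤? y
  ... | yes x≤y = x≤y
  ... | no  x≰y = contradiction h (ℤ.<⇒≱ (ℤ.≤-<-trans
        (ℤ.*-monoˡ-≤-nonNeg y {{ℤ.nonNegative 0≤y}} (ℤ.<⇒≤ y<x))
        (ℤ.*-monoʳ-<-pos x {{ℤ.positive (ℤ.≤-<-trans 0≤y y<x)}} y<x)))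
    where y<x = ℤ.≰⇒> x≰y

  -- Integrality matters: `x` is 0 or at least 1.
  ≤-square : ∀ {x} → 0ℤ ≤ x → x ≤ x * x
  ≤-square {+ zero}  _ = ℤ.≤-refl
  ≤-square {+ suc n} _ = subst (_≤ + suc n * + suc n) (ℤ.*-identityʳ (+ suc n))
    (ℤ.*-monoˡ-≤-nonNeg (+ suc n) (ℤ.+≤+ (ℕ.s≤s ℕ.z≤n)))

  -- Opaque, so that unification does not unfold sums.
  opaque
    sum : ∀ {n} → (Fin n → ℤ) → ℤ
    sum = Sum.sum

    sum-cong : ∀ {n} {f g : Fin n → ℤ} → (∀ i → f i ≡ g i) → sum f ≡ sum g
    sum-cong = Sum.sum-cong-≗

    sum-comm : ∀ {m n} (f : Fin m → Fin n → ℤ) →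
               sum (λ i → sum (f i)) ≡ sum (λ j → sum λ i → f i j)
    sum-comm = Sum.∑-comm

    sum-+ : ∀ {n} (f g : Fin n → ℤ) → sum (λ i → f i + g i) ≡ sum f + sum g
    sum-+ = Sum.∑-distrib-+

    sum-*ˡ : ∀ {n} c (f : Fin n → ℤ) → c * sum f ≡ sum (λ i → c * f i)
    sum-*ˡ = Sum.*-distribˡ-sum

    sum-*ʳ : ∀ {n} c (f : Fin n → ℤ) → sum f * c ≡ sum (λ i → f i * c)
    sum-*ʳ = Sum.*-distribʳ-sum

    sum-const : ∀ n c → sum {n} (λ _ → c) ≡ + n * c
    sum-const zero    c = sym (ℤ.*-zeroˡ c)
    sum-const (suc n) c = trans (cong (λ x → c + x) (sum-const n c)) (step (+ n) c)
      where
      step : ∀ n c → c + n * c ≡ (1ℤ + n) * c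
      step = solve-∀

    sum-mono : ∀ {n} {f g : Fin n → ℤ} → (∀ i → f i ≤ g i) → sum f ≤ sum g
    sum-mono {zero}  h = ℤ.≤-refl
    sum-mono {suc n} h = ℤ.+-mono-≤ (h zero) (sum-mono (h ∘ suc))

    sum-nonNeg : ∀ {n} {f : Fin n → ℤ} → (∀ i → 0ℤ ≤ f i) → 0ℤ ≤ sum f
    sum-nonNeg {zero}  h = ℤ.≤-refl
    sum-nonNeg {suc n} h = +-nonNeg (h zero) (sum-nonNeg (h ∘ suc))

    term≤sum : ∀ {n} {f : Fin n → ℤ} → (∀ i → 0ℤ ≤ f i) → ∀ i → f i ≤ sum f
    term≤sum {f = f} h zero = subst (_≤ sum f) (ℤ.+-identityʳ (f zero))
      (ℤ.+-monoʳ-≤ (f zero) (sum-nonNeg (h ∘ suc)))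
    term≤sum {f = f} h (suc i) = subst (_≤ sum f) (ℤ.+-identityˡ (f (suc i)))
      (ℤ.+-mono-≤ (h zero) (term≤sum (h ∘ suc) i))

    sum≢0⇒term≢0 : ∀ {n} {f : Fin n → ℤ} → sum f ≢ 0ℤ → ∃ λ i → f i ≢ 0ℤ
    sum≢0⇒term≢0 {zero}      h = contradiction refl h
    sum≢0⇒term≢0 {suc n} {f} h with f zero ℤ.≟ 0ℤ
    ... | no  f0≢0 = zero , f0≢0
    ... | yes f0≡0 with sum≢0⇒term≢0 {f = f ∘ suc} (λ e → h (cong₂ _+_ f0≡0 e))
    ...   | i , fi≢0 = suc i , fi≢0

  sum-lin₃ : ∀ {n} a b c (f g h : Fin n → ℤ) →
             sum (λ i → a * f i + b * g i + c * h i) ≡ a * sum f + b * sum g + c * sum h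
  sum-lin₃ a b c f g h = trans (sum-+ _ _)
    (cong₂ _+_ (trans (sum-+ _ _) (cong₂ _+_ (sym (sum-*ˡ a f)) (sym (sum-*ˡ b g))))
               (sym (sum-*ˡ c h)))

  infix 8 _·_

  _·_ : ∀ {n} → (Fin n → ℤ) → (Fin n → ℤ) → ℤ
  x · y = sum λ i → x i * y i

  apply : ∀ {m n} → (Fin m → Fin n → ℤ) → (Fin n → ℤ) → Fin m → ℤ
  apply K y i = K i · y

  adjoint : ∀ {m n} (K : Fin m → Fin n → ℤ) x y →
            apply K y · x ≡ y · apply (λ j i → K i j) x
  adjoint {m} {n} K x y = begin
    sum (λ i → sum (λ j → K i j * y j) * x i)
      ≡⟨ sum-cong (λ i → sum-*ʳ (x i) _) ⟩
    sum (λ i → sum (λ j → K i j * y j * x i))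
      ≡⟨ sum-comm (λ i j → K i j * y j * x i) ⟩
    sum (λ j → sum (λ i → K i j * y j * x i))
      ≡⟨ sum-cong (λ j → trans (sum-cong λ i → swap (K i j) (y j) (x i))
           (sym (sum-*ˡ (y j) _))) ⟩
    sum (λ j → y j * sum (λ i → K i j * x i)) ∎
    where
    open ≡-Reasoning
    swap : ∀ a b c → a * b * c ≡ b * (a * c)
    swap = solve-∀

  apply-apply : ∀ {l m n} (K : Fin l → Fin m → ℤ) (L : Fin m → Fin n → ℤ) y i →
                apply K (apply L y) i ≡ apply (λ i j → K i · (λ x → L x j)) y i
  apply-apply K L y i = trans (commuted) (trans (adjoint L (K i) y) (sum-cong λ j → trans
    (ℤ.*-comm (y j) _) (cong (_* y j) (sum-cong λ x → ℤ.*-comm (L x j) (K i x)))))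
    where
    commuted : K i · apply L y ≡ apply L y · K i
    commuted = sum-cong λ x → ℤ.*-comm (K i x) (apply L y x)

  ·-lin₃ : ∀ {n} (x : Fin n → ℤ) a b c (f g h : Fin n → ℤ) →
           x · (λ i → a * f i + b * g i + c * h i) ≡ a * x · f + b * x · g + c * x · h
  ·-lin₃ x a b c f g h = trans
    (sum-cong λ i → expand (x i) a b c (f i) (g i) (h i))
    (sum-lin₃ a b c _ _ _)
    where
    expand : ∀ x a b c f g h →
             x * (a * f + b * g + c * h) ≡ a * (x * f) + b * (x * g) + c * (x * h)
    expand = solve-∀

  ·-self-nonNeg : ∀ {n} (x : Fin n → ℤ) → 0ℤ ≤ x · x
  ·-self-nonNeg x = sum-nonNeg λ i → square-nonNeg (x i)

  -- Lagrange's identity: twice the difference of the two sides is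
  -- ∑ᵢ ∑ⱼ (xᵢ yⱼ - xⱼ yᵢ)².
  cauchy-schwarz : ∀ {n} (x y : Fin n → ℤ) → (x · y) * (x · y) ≤ (x · x) * (y · y)
  cauchy-schwarz x y = *-cancelˡ-≤ {z = + 2} (ℤ.+<+ (ℕ.s≤s ℕ.z≤n)) (≤-by nonNeg (sym lagrange))
    where
    D = sum λ i → sum λ j → (x i * y j - x j * y i) * (x i * y j - x j * y i)
    nonNeg : 0ℤ ≤ D
    nonNeg = sum-nonNeg λ i → sum-nonNeg λ j → square-nonNeg (x i * y j - x j * y i)
    expand : ∀ a b c d → (a * d - c * b) * (a * d - c * b) ≡
             (a * a) * (d * d) + (- (+ 2) * (a * b)) * (c * d) + (b * b) * (c * c)
    expand = solve-∀
    regroup : ∀ X Y Z a b → a * a * Y + - (+ 2) * (a * b) * Z + b * b * X ≡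
              Y * (a * a) + (- (+ 2) * Z) * (a * b) + X * (b * b)
    regroup = solve-∀
    collect : ∀ X Y Z → Y * X + (- (+ 2) * Z) * Z + X * Y ≡ + 2 * (X * Y) - + 2 * (Z * Z)
    collect = solve-∀
    lagrange : D ≡ + 2 * ((x · x) * (y · y)) - + 2 * ((x · y) * (x · y))
    lagrange = trans
      (sum-cong λ i → trans
        (trans (sum-cong λ j → expand (x i) (y i) (x j) (y j))
               (sum-lin₃ (x i * x i) (- (+ 2) * (x i * y i)) (y i * y i) _ _ _))
        (regroup (x · x) (y · y) (x · y) (x i) (y i)))
      (trans (sum-lin₃ (y · y) (- (+ 2) * x · y) (x · x) _ _ _)
             (collect (x · x) (y · y) (x · y)))

  -- Indicators: counts and set sizes as integer sums.

  ind : ∀ {P : Set} → Dec P → ℤ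
  ind P? = if does P? then 1ℤ else 0ℤ

  ind-true : ∀ {P : Set} (P? : Dec P) → P → ind P? ≡ 1ℤ
  ind-true (yes _) _ = refl
  ind-true (no ¬p) p = contradiction p ¬p

  ind-false : ∀ {P : Set} (P? : Dec P) → ¬ P → ind P? ≡ 0ℤ
  ind-false (yes p) ¬p = contradiction p ¬p
  ind-false (no _)  _  = refl

  ind≢0 : ∀ {P : Set} (P? : Dec P) → ind P? ≢ 0ℤ → P
  ind≢0 (yes p) _ = p
  ind≢0 (no _)  h = contradiction refl h

  ind-nonNeg : ∀ {P : Set} (P? : Dec P) → 0ℤ ≤ ind P?
  ind-nonNeg (yes _) = ℤ.+≤+ ℕ.z≤n
  ind-nonNeg (no _)  = ℤ.+≤+ ℕ.z≤n

  ind≤1 : ∀ {P : Set} (P? : Dec P) → ind P? ≤ 1ℤ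
  ind≤1 (yes _) = ℤ.+≤+ (ℕ.s≤s ℕ.z≤n)
  ind≤1 (no _)  = ℤ.+≤+ ℕ.z≤n

  ind-idem : ∀ {P : Set} (P? : Dec P) → ind P? * ind P? ≡ ind P?
  ind-idem (yes _) = refl
  ind-idem (no _)  = refl

  ind-⇔ : ∀ {P Q : Set} (P? : Dec P) (Q? : Dec Q) → (P → Q) → (Q → P) → ind P? ≡ ind Q?
  ind-⇔ (yes p) Q? f g = sym (ind-true Q? (f p))
  ind-⇔ (no ¬p) Q? f g = sym (ind-false Q? (¬p ∘ g))

  ind-× : ∀ {P Q R : Set} (P? : Dec P) (Q? : Dec Q) (R? : Dec R) →
          (P → Q → R) → (R → P × Q) → ind P? * ind Q? ≡ ind R?
  ind-× (yes p) (yes q) R? f g = sym (ind-true R? (f p q))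
  ind-× (yes p) (no ¬q) R? f g = sym (ind-false R? (¬q ∘ proj₂ ∘ g))
  ind-× (no ¬p) Q?      R? f g =
    trans (ℤ.*-zeroˡ (ind Q?)) (sym (ind-false R? (¬p ∘ proj₁ ∘ g)))

  δ : ∀ {n} → Fin n → Fin n → ℤ
  δ i j = ind (i ≟ j)

  opaque
    unfolding sum

    δ-· : ∀ {n} (i : Fin n) (x : Fin n → ℤ) → δ i · x ≡ x i
    δ-· {suc n} zero x = trans
      (cong₂ _+_ (ℤ.*-identityˡ (x zero)) (trans (sum-const n 0ℤ) (ℤ.*-zeroʳ (+ n))))
      (ℤ.+-identityʳ (x zero))
    δ-· (suc i) x = trans (ℤ.+-identityˡ _) (δ-· i (x ∘ suc))

  δ-sum : ∀ {n} (i : Fin n) → sum (δ i) ≡ 1ℤ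
  δ-sum i = trans (sum-cong λ j → sym (ℤ.*-identityʳ (δ i j))) (δ-· i (λ _ → 1ℤ))

  opaque
    unfolding sum

    count-tabulate : ∀ {A : Set} {P : U.Pred A _} (P? : U.Decidable P) {n} (f : Fin n → A) →
                     + count P? (tabulate f) ≡ sum λ i → ind (P? (f i))
    count-tabulate P? {zero}  f = refl
    count-tabulate P? {suc n} f with does (P? (f zero))
    ... | true  = cong (λ x → 1ℤ + x) (count-tabulate P? (f ∘ suc))
    ... | false = trans (count-tabulate P? (f ∘ suc)) (sym (ℤ.+-identityˡ _))

    ∣∣-sum : ∀ {n} (S : Subset n) → + ∣ S ∣ ≡ sum λ i → ind (i ∈? S)
    ∣∣-sum []            = refl
    ∣∣-sum (inside  ∷ S) = cong (λ x → 1ℤ + x) (∣∣-sum S)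
    ∣∣-sum (outside ∷ S) = trans (∣∣-sum S) (sym (ℤ.+-identityˡ _))

  #-sum : ∀ {n} {P : U.Pred (Fin n) _} (P? : U.Decidable P) → + (# P?) ≡ sum λ i → ind (P? i)
  #-sum P? = count-tabulate P? id

  -- Quadratic forms and the spectral inequality.

  sum-apply : ∀ {m n} (K : Fin m → Fin n → ℤ) y {c} →
              (∀ j → sum (λ i → K i j) ≡ c) → sum (apply K y) ≡ c * sum y
  sum-apply K y {c} h = begin
    sum (λ i → sum λ j → K i j * y j)  ≡⟨ sum-comm _ ⟩
    sum (λ j → sum λ i → K i j * y j)  ≡⟨ sum-cong (λ j → trans (sym (sum-*ʳ (y j) _)) (cong (_* y j) (h j))) ⟩
    sum (λ j → c * y j)                ≡⟨ sym (sum-*ˡ c y) ⟩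
    c * sum y                          ∎
    where open ≡-Reasoning

  -- ‖K y‖² is the quadratic form of KᵀK, whose entries are the inner products of the columns of
  -- `K`. With K = A it evaluates ‖A y‖², which Cauchy-Schwarz compares with ⟨y , A y⟩; with K = Mᵀ
  -- it brings in M Mᵀ.
  gram : ∀ {m n} (K : Fin m → Fin n → ℤ) (B : Fin n → Fin n → ℤ) y →
         (∀ p q → (λ x → K x p) · (λ x → K x q) ≡ B p q) →
         apply K y · apply K y ≡ y · apply B y
  gram K B y h = trans (adjoint K (apply K y) y)
    (sum-cong λ p → cong (y p *_) (trans (apply-apply (λ p x → K x p) K y p)
      (sum-cong λ q → cong (_* y q) (h p q))))

  -- The matrix is a I + b A + c J. The form of J is the square of the coordinate sum, so it
  -- disappears on vectors orthogonal to the all-one vector.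
  form-lin : ∀ {n} (A : Fin n → Fin n → ℤ) a b c y →
             y · apply (λ p q → a * δ p q + b * A p q + c * 1ℤ) y ≡
             a * y · y + b * y · apply A y + c * (sum y * sum y)
  form-lin A a b c y = begin
    y · apply (λ p q → a * δ p q + b * A p q + c * 1ℤ) y
      ≡⟨ sum-cong (λ p → cong (y p *_) (row p)) ⟩
    y · (λ p → a * y p + b * apply A y p + c * sum y)
      ≡⟨ ·-lin₃ y a b c y (apply A y) (λ _ → sum y) ⟩
    a * y · y + b * y · apply A y + c * y · (λ _ → sum y)
      ≡⟨ cong (λ x → a * y · y + b * y · apply A y + c * x) (sym (sum-*ʳ (sum y) y)) ⟩
    a * y · y + b * y · apply A y + c * (sum y * sum y) ∎
    where
    open ≡-Reasoning
    expand : ∀ a b c d e y → (a * d + b * e + c * 1ℤ) * y ≡ a * (d * y) + b * (e * y) + c * y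
    expand = solve-∀
    row : ∀ p → apply (λ p q → a * δ p q + b * A p q + c * 1ℤ) y p ≡
                a * y p + b * apply A y p + c * sum y
    row p = trans (sum-cong λ q → expand a b c (δ p q) (A p q) (y q))
      (trans (sum-lin₃ a b c _ _ y)
        (cong (λ x → a * x + b * apply A y p + c * sum y) (δ-· p y)))

  -- The hypothesis says A² = (k - μ) I + (ƛ - μ) A + μ J, so on the vectors
  -- orthogonal to 1 the eigenvalues of A are (ƛ - μ ± √Δ) / 2.
  spectral-bound : ∀ {n} (A : Fin n → Fin n → ℤ) k ƛ μ y →
    (∀ p q → (λ x → A x p) · (λ x → A x q) ≡ (k - μ) * δ p q + (ƛ - μ) * A p q + μ * 1ℤ) →
    sum y ≡ 0ℤ →
    let P = y · y
        Z = + 2 * (y · apply A y) - (ƛ - μ) * P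
    in Z * Z ≤ ((ƛ - μ) * (ƛ - μ) + + 4 * (k - μ)) * (P * P)
  spectral-bound A k ƛ μ y A² Σy≡0 =
    ≤-by (*-nonNeg {+ 4} (ℤ.+≤+ ℕ.z≤n) (ℤ.i≤j⇒0≤j-i (cauchy-schwarz y (apply A y))))
      (trans (difference P R (k - μ) (ƛ - μ)) (cong (λ S → + 4 * (P * S - R * R)) (sym S≡)))
    where
    P = y · y
    R = y · apply A y
    zero-last : ∀ a b → a + b + μ * (0ℤ * 0ℤ) ≡ a + b
    zero-last a b = trans (cong (λ x → a + b + x) (ℤ.*-zeroʳ μ)) (ℤ.+-identityʳ (a + b))
    S≡ : apply A y · apply A y ≡ (k - μ) * P + (ƛ - μ) * R
    S≡ = trans (gram A _ y A²) (trans (form-lin A (k - μ) (ƛ - μ) μ y)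
      (trans (cong (λ x → (k - μ) * P + (ƛ - μ) * R + μ * (x * x)) Σy≡0)
             (zero-last ((k - μ) * P) ((ƛ - μ) * R))))
    difference : ∀ P R u w → (w * w + + 4 * u) * (P * P) - (+ 2 * R - w * P) * (+ 2 * R - w * P) ≡
                 + 4 * (P * (u * P + w * R) - R * R)
    difference = solve-∀

  -- Elimination of √Δ in favour of rational approximations.

  -- Multiplying the two hypotheses gives (Z L)² ≤ (P σ)², and P σ ≥ 0 allows the squares to be
  -- dropped. For L > 0 the fraction σ / L is an upper approximation of √Δ, so this is the usable
  -- form of Z ≤ √Δ P.
  √-bound : ∀ Z {P Δ L σ} → 0ℤ ≤ P → 0ℤ ≤ σ → Z * Z ≤ Δ * (P * P) → Δ * (L * L) ≤ σ * σ →
            Z * L ≤ P * σ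
  √-bound Z {P} {Δ} {L} {σ} 0≤P 0≤σ hZ hΔ = square-cancel-≤ (*-nonNeg 0≤P 0≤σ)
    (≤-by (+-nonNeg (*-nonNeg (square-nonNeg L) (ℤ.i≤j⇒0≤j-i hZ))
                    (*-nonNeg (square-nonNeg P) (ℤ.i≤j⇒0≤j-i hΔ)))
          (certificate Z P Δ L σ))
    where
    certificate : ∀ Z P Δ L σ → P * σ * (P * σ) - Z * L * (Z * L) ≡
                  L * L * (Δ * (P * P) - Z * Z) + P * P * (σ * σ - Δ * (L * L))
    certificate = solve-∀

  0≤+ : ∀ {n} → 0ℤ ≤ + n
  0≤+ = ℤ.+≤+ ℕ.z≤n

  -- Read `P` = ‖y′‖², `E` = ‖e′‖², `W` = ‖Mᵀ y′‖² and `R` = ⟨y′ , A y′⟩, where e′ is the centred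
  -- codeword of weight `d` and y′ = M e′. Cauchy-Schwarz and the spectral inequality bound `P`
  -- above by a multiple of `E`; comparison with the lower bound on `P` leaves the common factor n
  -- d, which is cancelled.
  bit-bound : ∀ {n d s t w L σ Δ P E W R} →
    0ℤ < n → 0ℤ < d → 0ℤ ≤ t → 0ℤ ≤ L → 0ℤ ≤ σ → 0ℤ ≤ P → 0ℤ ≤ E →
    n * d * (s + 1ℤ) * (+ 2 * n - d * (t + 1ℤ)) ≤ P →
    E ≡ n * d * (n - d) → P * P ≤ E * W → W ≡ (t + 1ℤ) * P + R →
    (+ 2 * R - w * P) * (+ 2 * R - w * P) ≤ Δ * (P * P) → Δ * (L * L) ≤ σ * σ →
    (w + + 2) * (w + + 2) ≤ Δ →
    (n * (+ 4 * s - + 2 * t + + 2 - w) - d * (+ 2 * (s * (t + 1ℤ)) - w)) * L ≤ (n - d) * σ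
  bit-bound {n} {d} {s} {t} {w} {L} {σ} {Δ} {P} {E} {W} {R}
    0<n 0<d 0≤t 0≤L 0≤σ 0≤P 0≤E hP refl hCS refl hZ hΔ hw =
    *-cancelˡ-≤ (*-pos 0<n 0<d) (ℤ.≤-trans
      (≤-by (*-nonNeg (*-nonNeg {+ 2} 0≤+ 0≤L) (ℤ.i≤j⇒0≤j-i hP)) (certificate n d s t w L P))
      (ℤ.≤-trans (centred (P ℤ.≟ 0ℤ)) (ℤ.≤-reflexive (ℤ.*-assoc (n * d) (n - d) σ))))
    where
    certificate : ∀ n d s t w L P →
      (+ 2 * P - n * d * (n - d) * (+ 2 * (t + 1ℤ) + w)) * L -
      n * d * ((n * (+ 4 * s - + 2 * t + + 2 - w) - d * (+ 2 * (s * (t + 1ℤ)) - w)) * L) ≡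
      + 2 * L * (P - n * d * (s + 1ℤ) * (+ 2 * n - d * (t + 1ℤ)))
    certificate = solve-∀
    opposite : ∀ w → (- (w + + 2)) * (- (w + + 2)) ≡ (w + + 2) * (w + + 2)
    opposite = solve-∀
    -w-2≤√Δ : (- (w + + 2)) * L ≤ 1ℤ * σ
    -w-2≤√Δ = √-bound (- (w + + 2)) {P = 1ℤ} {Δ = Δ} {L = L} 0≤+ 0≤σ
      (ℤ.≤-trans (ℤ.≤-reflexive (opposite w)) (ℤ.≤-trans hw (ℤ.≤-reflexive (sym (ℤ.*-identityʳ Δ))))) hΔ
    zero-case : ∀ t w L σ E → E * σ - (+ 2 * 0ℤ - E * (+ 2 * (t + 1ℤ) + w)) * L ≡
                E * (1ℤ * σ - (- (w + + 2)) * L) + + 2 * (E * (t * L))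
    zero-case = solve-∀
    pos-case : ∀ t w L σ P E R → P * (E * σ) - P * ((+ 2 * P - E * (+ 2 * (t + 1ℤ) + w)) * L) ≡
               E * (P * σ - (+ 2 * R - w * P) * L) + + 2 * L * (E * ((t + 1ℤ) * P + R) - P * P)
    pos-case = solve-∀
    -- With √Δ for σ / L this is 2 P ≤ E (2 (t + 1) + w + √Δ). It follows from Cauchy-Schwarz after
    -- division by `P`. If P = 0, it is enough that the bracket is nonnegative, and `-w-2≤√Δ` makes
    -- it at least 2 t.
    centred : Dec (P ≡ 0ℤ) → (+ 2 * P - E * (+ 2 * (t + 1ℤ) + w)) * L ≤ E * σ
    centred (yes P≡0) = subst (λ P → (+ 2 * P - E * (+ 2 * (t + 1ℤ) + w)) * L ≤ E * σ) (sym P≡0)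
      (≤-by (+-nonNeg (*-nonNeg 0≤E (ℤ.i≤j⇒0≤j-i -w-2≤√Δ))
                      (*-nonNeg {+ 2} 0≤+ (*-nonNeg 0≤E (*-nonNeg 0≤t 0≤L))))
            (zero-case t w L σ E))
    centred (no P≢0) = *-cancelˡ-≤ (ℤ.≤∧≢⇒< 0≤P (λ e → P≢0 (sym e)))
      (≤-by (+-nonNeg (*-nonNeg 0≤E (ℤ.i≤j⇒0≤j-i (√-bound (+ 2 * R - w * P) {P = P} {Δ = Δ} {L = L} 0≤P 0≤σ hZ hΔ)))
                      (*-nonNeg (*-nonNeg {+ 2} 0≤+ 0≤L) (ℤ.i≤j⇒0≤j-i hCS)))
            (pos-case t w L σ P E R))

  -- Read `P` = ‖z′‖² and `R` = ⟨z′ , A z′⟩ for the centred indicator z′ of the `m` points met by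
  -- the codeword. The spectral inequality caps 2 R - w P at √Δ P; both `P` and the lower bound on
  -- `R` carry the factor v m, which is cancelled.
  parity-bound : ∀ {v m s k w L σ Δ P R} →
    0ℤ < v → 0ℤ < m → 0ℤ ≤ L → 0ℤ ≤ σ → 0ℤ ≤ P →
    v * m * (+ 2 * s * v - k * m) ≤ R → P ≡ v * m * (v - m) →
    (+ 2 * R - w * P) * (+ 2 * R - w * P) ≤ Δ * (P * P) → Δ * (L * L) ≤ σ * σ →
    (v * (+ 4 * s - w) - m * (+ 2 * k - w)) * L ≤ (v - m) * σ
  parity-bound {v} {m} {s} {k} {w} {L} {σ} {Δ} {P} {R} 0<v 0<m 0≤L 0≤σ 0≤P hR refl hZ hΔ =
    *-cancelˡ-≤ (*-pos 0<v 0<m) (ℤ.≤-trans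
      (≤-by (*-nonNeg (*-nonNeg {+ 2} 0≤+ 0≤L) (ℤ.i≤j⇒0≤j-i hR)) (certificate v m s k w L R))
      (ℤ.≤-trans (√-bound (+ 2 * R - w * (v * m * (v - m))) {Δ = Δ} {L = L} 0≤P 0≤σ hZ hΔ)
                 (ℤ.≤-reflexive (ℤ.*-assoc (v * m) (v - m) σ))))
    where
    certificate : ∀ v m s k w L R →
      (+ 2 * R - w * (v * m * (v - m))) * L -
      v * m * ((v * (+ 4 * s - w) - m * (+ 2 * k - w)) * L) ≡
      + 2 * L * (R - v * m * (+ 2 * s * v - k * m))
    certificate = solve-∀

  -- Transfers the bound on the number m of points met by a codeword to its weight d.
  parity-bound-weight : ∀ {v n d m s t a b L ρ} →
    0ℤ < v → 0ℤ ≤ n → 0ℤ ≤ m → n * (s + 1ℤ) ≡ v * (t + 1ℤ) → + 2 * m ≤ (s + 1ℤ) * d →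
    0ℤ ≤ b * L - ρ → (v * a - m * b) * L ≤ (v - m) * (ρ + 1ℤ) →
    + 2 * n * (a * L - ρ) ≤ (t + 1ℤ) * d * (b * L - ρ) + + 2 * n
  parity-bound-weight {v} {n} {d} {m} {s} {t} {a} {b} {L} {ρ} 0<v 0≤n 0≤m flags 2m≤ 0≤w h =
    *-cancelˡ-≤ 0<v (≤-by
      (+-nonNeg (+-nonNeg (*-nonNeg (*-nonNeg {+ 2} 0≤+ 0≤n) (ℤ.i≤j⇒0≤j-i h))
                          (*-nonNeg (*-nonNeg {+ 2} 0≤+ 0≤n) 0≤m))
                (*-nonNeg (*-nonNeg 0≤n 0≤w) (ℤ.i≤j⇒0≤j-i 2m≤)))
      (trans (regroup v n d t a b L ρ)
        (trans (cong (λ x → x * (d * (b * L - ρ)) + + 2 * n * v - + 2 * n * (v * (a * L - ρ))) (sym flags))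
          (certificate v n d m s a b L ρ))))
    where
    regroup : ∀ v n d t a b L ρ →
      v * ((t + 1ℤ) * d * (b * L - ρ) + + 2 * n) - v * (+ 2 * n * (a * L - ρ)) ≡
      (v * (t + 1ℤ)) * (d * (b * L - ρ)) + + 2 * n * v - + 2 * n * (v * (a * L - ρ))
    regroup = solve-∀
    certificate : ∀ v n d m s a b L ρ →
      n * (s + 1ℤ) * (d * (b * L - ρ)) + + 2 * n * v - + 2 * n * (v * (a * L - ρ)) ≡
      + 2 * n * ((v - m) * (ρ + 1ℤ) - (v * a - m * b) * L) + + 2 * n * m +
      n * (b * L - ρ) * ((s + 1ℤ) * d - + 2 * m)
    certificate = solve-∀

  -- The distance between `b` and √Δ.

  module _ {b Δ μv L ρ} (0≤b : 0ℤ ≤ b) (0≤L : 0ℤ ≤ L)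
           (gap : b * b - Δ ≡ + 4 * μv) (1≤μv : 1ℤ ≤ μv) (ρ²≤ : ρ * ρ ≤ Δ * (L * L)) where

    private
      0≤μv : 0ℤ ≤ μv
      0≤μv = ℤ.≤-trans 0≤+ 1≤μv

    √<b : 0ℤ ≤ b * L - ρ
    √<b = ℤ.i≤j⇒0≤j-i (square-cancel-≤ (*-nonNeg 0≤b 0≤L) (≤-by
      (+-nonNeg (ℤ.i≤j⇒0≤j-i ρ²≤) (*-nonNeg (*-nonNeg {+ 4} 0≤+ 0≤μv) (square-nonNeg L)))
      (trans (certificate b Δ L ρ) (cong (λ x → (Δ * (L * L) - ρ * ρ) + x * (L * L)) gap))))
      where
      certificate : ∀ b Δ L ρ → b * L * (b * L) - ρ * ρ ≡ (Δ * (L * L) - ρ * ρ) + (b * b - Δ) * (L * L)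
      certificate = solve-∀

    -- The product 2 b L (b L - ρ) equals (b L - ρ)² + (b L)² - ρ², hence is at least (b² - Δ) L² ≥
    -- 4 L². The resulting gap 1 / b between b and ρ / L does not depend on `L`, so it shows that b
    -- - √Δ is apart from 0.
    √-gap : 0ℤ < L → L ≤ b * (b * L - ρ)
    √-gap 0<L = *-cancelˡ-≤ (*-pos {+ 2} (ℤ.+<+ (ℕ.s≤s ℕ.z≤n)) 0<L) (≤-by
      (+-nonNeg (+-nonNeg (+-nonNeg (ℤ.i≤j⇒0≤j-i ρ²≤) (square-nonNeg (b * L - ρ)))
                          (*-nonNeg {+ 2} 0≤+ (square-nonNeg L)))
                (*-nonNeg (*-nonNeg {+ 4} 0≤+ (ℤ.i≤j⇒0≤j-i 1≤μv)) (square-nonNeg L)))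
      (trans (certificate b Δ L ρ)
        (trans (cong (λ x → (Δ * (L * L) - ρ * ρ) + (b * L - ρ) * (b * L - ρ) + x * (L * L) - + 2 * (L * L)) gap)
               (split ((Δ * (L * L) - ρ * ρ) + (b * L - ρ) * (b * L - ρ)) μv L))))
      where
      certificate : ∀ b Δ L ρ → + 2 * L * (b * (b * L - ρ)) - + 2 * L * L ≡
        (Δ * (L * L) - ρ * ρ) + (b * L - ρ) * (b * L - ρ) + (b * b - Δ) * (L * L) - + 2 * (L * L)
      certificate = solve-∀
      split : ∀ x μv L → x + + 4 * μv * (L * L) - + 2 * (L * L) ≡
              x + + 2 * (L * L) + + 4 * (μv - 1ℤ) * (L * L)
      split = solve-∀

-- Parity of integer counts, and affine changes of vectors.

module Geometry where

  open LinearAlgebra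
  open import Data.Integer.Base using (_+_; _*_; _-_; -_; _≤_; _<_)

  opaque
    unfolding sum

    -- Connects the two arithmetics: the number of ones in a binary word, counted in ℤ, reduces
    -- modulo 2 to the sum of the word in `Parity`. Through it a parity check becomes the evenness
    -- of an integer.
    sum-parity : ∀ {n} (f : Fin n → Parity) →
                 ∃ λ m → sum (λ i → ind (f i ℙ.≟ 1ℙ)) ≡ + m × parity m ≡ sumℙ f
    sum-parity {zero}  f = 0 , refl , refl
    sum-parity {suc n} f with f zero | sum-parity (f ∘ suc)
    ... | 0ℙ | m , eq , par = m , trans (ℤ.+-identityˡ _) eq , par
    ... | 1ℙ | m , eq , par = suc m , cong (λ x → 1ℤ + x) eq ,
                              trans (ℙ.+-homo-+ 1 m) (cong (1ℙ ℙ.+_) par)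

  ind-parity : ∀ {P : Set} (P? : Dec P) x →
               ind P? * ind (x ℙ.≟ 1ℙ) ≡ ind ((if does P? then 1ℙ else 0ℙ) ℙ.* x ℙ.≟ 1ℙ)
  ind-parity (yes _) 0ℙ = refl
  ind-parity (yes _) 1ℙ = refl
  ind-parity (no _)  0ℙ = refl
  ind-parity (no _)  1ℙ = refl

  Fin⇒0<n : ∀ {n} → Fin n → 0ℤ < + n
  Fin⇒0<n {suc _} _ = ℤ.+<+ (ℕ.s≤s ℕ.z≤n)

  ≢0⇒0<+ : ∀ {n} → n ≢ 0 → 0ℤ < + n
  ≢0⇒0<+ {zero}  h = contradiction refl h
  ≢0⇒0<+ {suc _} _ = ℤ.+<+ (ℕ.s≤s ℕ.z≤n)

  ≢0⇒Fin : ∀ {n} → n ≢ 0 → Fin n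
  ≢0⇒Fin {zero}  h = contradiction refl h
  ≢0⇒Fin {suc _} _ = zero

  0<⇒≢0 : ∀ {x} → 0ℤ < x → x ≢ 0ℤ
  0<⇒≢0 0<x x≡0 = ℤ.<-irrefl (sym x≡0) 0<x

  affine-sum : ∀ {n} a b (x : Fin n → ℤ) → sum (λ i → a * x i + b) ≡ a * sum x + + n * b
  affine-sum {n} a b x = trans (sum-+ _ _) (cong₂ _+_ (sym (sum-*ˡ a x)) (sum-const n b))

  affine-· : ∀ {n} a b (x y : Fin n → ℤ) c e →
             (λ i → a * x i + b) · (λ i → c * y i + e) ≡
             a * c * x · y + a * e * sum x + b * c * sum y + + n * (b * e)
  affine-· {n} a b x y c e = trans
    (sum-cong λ i → expand a b (x i) (y i) c e)
    (trans (sum-+ _ _) (cong₂ _+_ (sum-lin₃ (a * c) (a * e) (b * c) _ x y) (sum-const n (b * e))))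
    where
    expand : ∀ a b x y c e → (a * x + b) * (c * y + e) ≡
             a * c * (x * y) + a * e * x + b * c * y + b * e
    expand = solve-∀

  apply-affine : ∀ {m n} (K : Fin m → Fin n → ℤ) a b x i →
                 apply K (λ j → a * x j + b) i ≡ a * apply K x i + b * sum (K i)
  apply-affine K a b x i = trans (sum-cong λ j → expand (K i j) a b (x j))
    (trans (sum-+ _ _) (cong₂ _+_ (sym (sum-*ˡ a _)) (sym (sum-*ˡ b (K i)))))
    where
    expand : ∀ k a b x → k * (a * x + b) ≡ a * (k * x) + b * k
    expand = solve-∀

  -- Matrix identities of the geometry and its point graph.

  module SRPG {v n r} (S : IncidenceStructure v n) (s t : ℕ) (α : Fin r → ℕ) (ƛ μ : ℕ)
              (srpg : IsSRPG S s t α ƛ μ) where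
    open IncidenceStructure S
    open IsSRPG srpg
    open IsPG isPG
    open IsStronglyRegular isStronglyRegular
    open Graph (pointGraph S)

    k = + s * (+ t + 1ℤ)

    M : Fin v → Fin n → ℤ
    M p j = ind (p ∈? block j)

    A : Fin v → Fin v → ℤ
    A p q = ind (p ~? q)

    block-sum : ∀ j → sum (λ p → M p j) ≡ + s + 1ℤ
    block-sum j = trans (sym (∣∣-sum (block j))) (cong +_ (blockSize j))

    point-sum : ∀ p → sum (M p) ≡ + t + 1ℤ
    point-sum p = trans (sym (#-sum λ j → p ∈? block j)) (cong +_ (pointDegree p))

    A-sum : ∀ p → sum (A p) ≡ k
    A-sum p = trans (sym (#-sum (p ~?_))) (trans (cong +_ (regular p)) (ℤ.pos-* s (t ℕ.+ 1)))

    A-sym : ∀ p q → A p q ≡ A q p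
    A-sym p q = ind-⇔ (p ~? q) (q ~? p) sym~ sym~

    A-diag : ∀ p → A p p ≡ 0ℤ
    A-diag p = ind-false (p ~? p) (irrefl refl)

    A-colsum : ∀ q → sum (λ p → A p q) ≡ k
    A-colsum q = trans (sum-cong λ p → A-sym p q) (A-sum q)

    A-common : ∀ p q → A p · A q ≡ + commonNeighbours p q
    A-common p q = trans
      (sum-cong λ z → ind-× (p ~? z) (q ~? z) ((p ~? z) ×-dec (q ~? z)) _,_ id)
      (sym (#-sum λ z → (p ~? z) ×-dec (q ~? z)))

    -- As `A` is symmetric, inner products of rows are the entries of A². The clauses of strong
    -- regularity give k on the diagonal, ƛ at adjacent pairs and μ at the remaining ones.
    A² : ∀ p q → A p · A q ≡ (k - + μ) * δ p q + (+ ƛ - + μ) * A p q + + μ * 1ℤ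
    A² p q = by-cases (p ≟ q)
      where
      rhs : ∀ {x a} → δ p q ≡ x → A p q ≡ a → (k - + μ) * x + (+ ƛ - + μ) * a + + μ * 1ℤ ≡
            (k - + μ) * δ p q + (+ ƛ - + μ) * A p q + + μ * 1ℤ
      rhs δ≡x A≡a = cong₂ (λ x a → (k - + μ) * x + (+ ƛ - + μ) * a + + μ * 1ℤ) (sym δ≡x) (sym A≡a)
      diagonal : ∀ k l m → k ≡ (k - m) * 1ℤ + (l - m) * 0ℤ + m * 1ℤ
      diagonal = solve-∀
      adj : ∀ k l m → l ≡ (k - m) * 0ℤ + (l - m) * 1ℤ + m * 1ℤ
      adj = solve-∀
      nonadj : ∀ k l m → m ≡ (k - m) * 0ℤ + (l - m) * 0ℤ + m * 1ℤ
      nonadj = solve-∀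
      off-diagonal : p ≢ q → Dec (p ~ q) → + commonNeighbours p q ≡
                     (k - + μ) * δ p q + (+ ƛ - + μ) * A p q + + μ * 1ℤ
      off-diagonal p≢q (yes p~q) = trans (cong +_ (adjacent p~q))
        (trans (adj k (+ ƛ) (+ μ)) (rhs (ind-false (p ≟ q) p≢q) (ind-true (p ~? q) p~q)))
      off-diagonal p≢q (no p≁q)  = trans (cong +_ (nonAdjacent p≢q p≁q))
        (trans (nonadj k (+ ƛ) (+ μ)) (rhs (ind-false (p ≟ q) p≢q) (ind-false (p ~? q) p≁q)))
      by-cases : Dec (p ≡ q) → A p · A q ≡ (k - + μ) * δ p q + (+ ƛ - + μ) * A p q + + μ * 1ℤ
      by-cases (yes refl) = trans (sum-cong λ z → ind-idem (p ~? z)) (trans (A-sum p)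
        (trans (diagonal k (+ ƛ) (+ μ)) (rhs (ind-true (p ≟ p) refl) (A-diag p))))
      by-cases (no p≢q) = trans (A-common p q) (off-diagonal p≢q (p ~? q))

    -- A point lies on t + 1 blocks; two distinct points share exactly one block if joined and none
    -- otherwise. The zero multiple of J gives the right-hand side the shape that `form-lin`
    -- expects.
    MMᵀ : ∀ p q → M p · M q ≡ (+ t + 1ℤ) * δ p q + 1ℤ * A p q + 0ℤ * 1ℤ
    MMᵀ p q = by-cases (p ≟ q)
      where
      rhs : ∀ {x a} → δ p q ≡ x → A p q ≡ a → (+ t + 1ℤ) * x + 1ℤ * a + 0ℤ * 1ℤ ≡
            (+ t + 1ℤ) * δ p q + 1ℤ * A p q + 0ℤ * 1ℤ
      rhs δ≡x A≡a = cong₂ (λ x a → (+ t + 1ℤ) * x + 1ℤ * a + 0ℤ * 1ℤ) (sym δ≡x) (sym A≡a)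
      diagonal : ∀ b → b ≡ b * 1ℤ + 1ℤ * 0ℤ + 0ℤ * 1ℤ
      diagonal = solve-∀
      off : ∀ b a → a ≡ b * 0ℤ + 1ℤ * a + 0ℤ * 1ℤ
      off = solve-∀
      off-diagonal : p ≢ q → Dec (Joined p q) → M p · M q ≡ A p q
      off-diagonal p≢q (yes (j , p∈j , q∈j)) = trans
        (sum-cong λ i → ind-× (p ∈? block i) (q ∈? block i) (j ≟ i)
          (λ p∈i q∈i → atMostOneBlock p≢q p∈j q∈j p∈i q∈i)
          (λ { refl → p∈j , q∈j }))
        (trans (δ-sum j) (sym (ind-true (p ~? q) (p≢q , j , p∈j , q∈j))))
      off-diagonal p≢q (no ¬joined) = trans
        (sum-cong λ i → ind-× (p ∈? block i) (q ∈? block i) (p ~? q)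
          (λ p∈i q∈i → contradiction (i , p∈i , q∈i) ¬joined)
          (λ p~q → contradiction (proj₂ p~q) ¬joined))
        (trans (sum-const n (A p q)) (trans (cong (+ n *_) p≁q) (trans (ℤ.*-zeroʳ (+ n)) (sym p≁q))))
        where
        p≁q : A p q ≡ 0ℤ
        p≁q = ind-false (p ~? q) (¬joined ∘ proj₂)
      by-cases : Dec (p ≡ q) → M p · M q ≡ (+ t + 1ℤ) * δ p q + 1ℤ * A p q + 0ℤ * 1ℤ
      by-cases (yes refl) = trans (sum-cong λ j → ind-idem (p ∈? block j)) (trans (point-sum p)
        (trans (diagonal (+ t + 1ℤ)) (rhs (ind-true (p ≟ p) refl) (A-diag p))))
      by-cases (no p≢q) = trans (off-diagonal p≢q (joined? p q))
        (trans (off (+ t + 1ℤ) (A p q)) (rhs (ind-false (p ≟ q) p≢q) refl))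

    -- Both sides count the incident point-block pairs.
    flags : + n * (+ s + 1ℤ) ≡ + v * (+ t + 1ℤ)
    flags = begin
      + n * (+ s + 1ℤ)                    ≡⟨ sum-const n (+ s + 1ℤ) ⟨
      sum {n} (λ _ → + s + 1ℤ)            ≡⟨ sum-cong block-sum ⟨
      sum (λ j → sum λ p → M p j)         ≡⟨ sum-comm M ⟨
      sum (λ p → sum (M p))               ≡⟨ sum-cong point-sum ⟩
      sum {v} (λ _ → + t + 1ℤ)            ≡⟨ sum-const v (+ t + 1ℤ) ⟩
      + v * (+ t + 1ℤ)                    ∎
      where open ≡-Reasoning

    somePoint : Fin v
    somePoint = ≢0⇒Fin nonEmpty

    -- Row sums of A² = (k - μ) I + (ƛ - μ) A + μ J.
    paths : k * k ≡ (k - + μ) + (+ ƛ - + μ) * k + + μ * + v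
    paths = begin
      k * k
        ≡⟨ cong (k *_) (A-sum p) ⟨
      k * sum (A p)
        ≡⟨ sum-*ˡ k (A p) ⟩
      sum (λ z → k * A p z)
        ≡⟨ sum-cong (λ z → trans (ℤ.*-comm k (A p z)) (cong (A p z *_) (sym (A-colsum z)))) ⟩
      sum (λ z → A p z * sum (λ q → A q z))
        ≡⟨ sum-cong (λ z → sum-*ˡ (A p z) _) ⟩
      sum (λ z → sum λ q → A p z * A q z)
        ≡⟨ sum-comm _ ⟩
      sum (λ q → A p · A q)
        ≡⟨ sum-cong (A² p) ⟩
      sum (λ q → (k - + μ) * δ p q + (+ ƛ - + μ) * A p q + + μ * 1ℤ)
        ≡⟨ sum-lin₃ (k - + μ) (+ ƛ - + μ) (+ μ) (δ p) (A p) (λ _ → 1ℤ) ⟩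
      (k - + μ) * sum (δ p) + (+ ƛ - + μ) * sum (A p) + + μ * sum {v} (λ _ → 1ℤ)
        ≡⟨ cong₂ _+_ (cong₂ _+_
             (trans (cong ((k - + μ) *_) (δ-sum p)) (ℤ.*-identityʳ (k - + μ)))
             (cong ((+ ƛ - + μ) *_) (A-sum p)))
             (cong (+ μ *_) (trans (sum-const v 1ℤ) (ℤ.*-identityʳ (+ v)))) ⟩
      (k - + μ) + (+ ƛ - + μ) * k + + μ * + v ∎
      where
      open ≡-Reasoning
      p = somePoint

    -- The common neighbours of `p` and `q` are among the neighbours of `p` other than `q`.
    edge⇒ƛ<k : ∀ {p q} → p ~ q → + ƛ ≤ k - 1ℤ
    edge⇒ƛ<k {p} {q} p~q = subst₂ _≤_
      (trans (A-common p q) (cong +_ (adjacent p~q)))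
      (trans (affine (A p) (δ q)) (cong₂ _-_ (A-sum p) (δ-sum q)))
      (sum-mono pointwise)
      where
      difference : ∀ x y → x - y ≡ 1ℤ * x + (- 1ℤ) * y + 0ℤ * y
      difference = solve-∀
      affine : ∀ (f g : Fin v → ℤ) → sum (λ z → f z - g z) ≡ sum f - sum g
      affine f g = trans (sum-cong λ z → difference (f z) (g z))
        (trans (sum-lin₃ 1ℤ (- 1ℤ) 0ℤ f g g) (sym (difference (sum f) (sum g))))
      x*y≤x : ∀ {P Q : Set} (P? : Dec P) (Q? : Dec Q) → ind P? * ind Q? ≤ ind P? - 0ℤ
      x*y≤x (yes _) Q? = ℤ.≤-trans (ℤ.≤-reflexive (ℤ.*-identityˡ (ind Q?))) (ind≤1 Q?)
      x*y≤x (no _)  Q? = ℤ.≤-refl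
      by-cases : ∀ z → Dec (q ≡ z) → A p z * A q z ≤ A p z - δ q z
      by-cases z (yes refl) = ℤ.≤-reflexive (trans (cong (A p q *_) (A-diag q))
        (trans (ℤ.*-zeroʳ (A p q))
          (sym (cong₂ _-_ (ind-true (p ~? q) p~q) (ind-true (q ≟ q) refl)))))
      by-cases z (no q≢z) = subst (λ x → A p z * A q z ≤ A p z - x)
        (sym (ind-false (q ≟ z) q≢z)) (x*y≤x (p ~? z) (q ~? z))
      pointwise : ∀ z → A p z * A q z ≤ A p z - δ q z
      pointwise z = by-cases z (q ≟ z)

    0<k⇒ƛ<k : 0ℤ < k → + ƛ ≤ k - 1ℤ
    0<k⇒ƛ<k 0<k = edge⇒ƛ<k (ind≢0 (somePoint ~? proj₁ neighbour) (proj₂ neighbour))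
      where
      neighbour : ∃ λ q → A somePoint q ≢ 0ℤ
      neighbour = sum≢0⇒term≢0 (0<⇒≢0 (subst (0ℤ <_) (sym (A-sum somePoint)) 0<k))

    singleton-blocks : s ≡ 0 → ∀ {p q j} → p ∈ block j → q ∈ block j → p ≡ q
    singleton-blocks s≡0 {p} {q} {j} p∈j q∈j with p ≟ q
    ... | yes p≡q = p≡q
    ... | no  p≢q = contradiction
      (subst₂ _≤_
        (trans (sum-+ (δ p) (δ q)) (cong₂ _+_ (δ-sum p) (δ-sum q)))
        (trans (block-sum j) (cong (λ x → + x + 1ℤ) s≡0))
        (sum-mono pointwise))
      λ { (ℤ.+≤+ (ℕ.s≤s ())) }
      where
      pointwise : ∀ z → δ p z + δ q z ≤ M z j
      pointwise z with p ≟ z | q ≟ z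
      ... | yes refl | yes refl = contradiction refl p≢q
      ... | yes refl | no _     = ℤ.≤-reflexive (sym (ind-true (p ∈? block j) p∈j))
      ... | no _     | yes refl = ℤ.≤-reflexive (sym (ind-true (q ∈? block j) q∈j))
      ... | no _     | no _     = ind-nonNeg (z ∈? block j)

    -- Both blocks are the singleton of `p`, and no block is repeated. This serves to exclude s = 0
    -- when a nonzero codeword exists.
    singleton-blocks⇒unique : s ≡ 0 → ∀ {p i j} → p ∈ block i → p ∈ block j → i ≡ j
    singleton-blocks⇒unique s≡0 {p} {i} {j} p∈i p∈j = injective (⊆-antisym
      (λ q∈i → subst (_∈ block j) (singleton-blocks s≡0 p∈i q∈i) p∈j)
      (λ q∈j → subst (_∈ block i) (singleton-blocks s≡0 p∈j q∈j) p∈i))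

    -- A nonzero codeword and the numerical constraints it forces.

    module Codeword (c : Vector Parity n) (c∈C : C (incidenceMatrix S) c) (c≢0 : NonZeroWord c) where

      d = + weight c

      -- e is the codeword as a 0/1 vector, y p the number of its blocks through
      -- p, and z the indicator of the points it meets.  Primes mark the multiples
      -- of the projections orthogonal to the all-one vector.
      e : Fin n → ℤ
      e j = ind (c j ℙ.≟ 1ℙ)

      e-sum : sum e ≡ d
      e-sum = sym (#-sum λ j → c j ℙ.≟ 1ℙ)

      y : Fin v → ℤ
      y = apply M e

      y-sum : sum y ≡ (+ s + 1ℤ) * d
      y-sum = trans (sum-apply M e block-sum) (cong ((+ s + 1ℤ) *_) e-sum)

      -- The check equation of row `p` says that `y p` is even, and an even natural number is 0 or
      -- at least 2.
      y-even : ∀ p → y p ≡ 0ℤ ⊎ + 2 ≤ y p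
      y-even p with sum-parity (λ j → incidenceMatrix S p j ℙ.* c j)
      ... | m , eq , par = subst (λ x → x ≡ 0ℤ ⊎ + 2 ≤ x)
        (sym (trans (sum-cong λ j → ind-parity (p ∈? block j) (c j)) eq))
        (even m (trans par (c∈C p)))
        where
        even : ∀ m → parity m ≡ 0ℙ → + m ≡ 0ℤ ⊎ + 2 ≤ + m
        even zero          _ = inj₁ refl
        even (suc (suc m)) _ = inj₂ (ℤ.+≤+ (ℕ.s≤s (ℕ.s≤s ℕ.z≤n)))

      Me-nonNeg : ∀ p j → 0ℤ ≤ M p j * e j
      Me-nonNeg p j = *-nonNeg (ind-nonNeg (p ∈? block j)) (ind-nonNeg (c j ℙ.≟ 1ℙ))

      Me≤M : ∀ p j → M p j * e j ≤ M p j
      Me≤M p j = subst (M p j * e j ≤_) (ℤ.*-identityʳ (M p j))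
        (ℤ.*-monoˡ-≤-nonNeg (M p j) {{ℤ.nonNegative (ind-nonNeg (p ∈? block j))}} (ind≤1 (c j ℙ.≟ 1ℙ)))

      y≤t+1 : ∀ p → y p ≤ + t + 1ℤ
      y≤t+1 p = subst (y p ≤_) (point-sum p) (sum-mono (Me≤M p))

      z : Fin v → ℤ
      z p = ind (¬? (y p ℤ.≟ 0ℤ))

      m = sum z

      2z≤y : ∀ p → + 2 * z p ≤ y p
      2z≤y p with y p ℤ.≟ 0ℤ | y-even p
      ... | yes y≡0 | _        = ℤ.≤-reflexive (sym y≡0)
      ... | no  y≢0 | inj₁ y≡0 = contradiction y≡0 y≢0
      ... | no  _   | inj₂ 2≤y = 2≤y

      zy≡y : ∀ p → z p * y p ≡ y p
      zy≡y p with y p ℤ.≟ 0ℤ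
      ... | yes y≡0 = trans (ℤ.*-zeroˡ (y p)) (sym y≡0)
      ... | no  _   = ℤ.*-identityˡ (y p)

      y≤[t+1]z : ∀ p → y p ≤ (+ t + 1ℤ) * z p
      y≤[t+1]z p with y p ℤ.≟ 0ℤ
      ... | yes y≡0 = ℤ.≤-reflexive (trans y≡0 (sym (ℤ.*-zeroʳ (+ t + 1ℤ))))
      ... | no  _   = subst (y p ≤_) (sym (ℤ.*-identityʳ (+ t + 1ℤ))) (y≤t+1 p)

      2y≤yy : ∀ p → + 2 * y p ≤ y p * y p
      2y≤yy p with y-even p
      ... | inj₁ y≡0 = ℤ.≤-reflexive (trans (cong (+ 2 *_) y≡0) (sym (cong₂ _*_ y≡0 y≡0)))
      ... | inj₂ 2≤y = ℤ.*-monoʳ-≤-nonNeg (y p) {{ℤ.nonNegative (ℤ.≤-trans (0≤+ {2}) 2≤y)}} 2≤y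

      0<d : 0ℤ < d
      0<d = ≢0⇒0<+ λ weight≡0 → c≢0 λ j → vanishes j (subst (e j ≤_) (trans e-sum (cong +_ weight≡0))
              (term≤sum (λ j → ind-nonNeg (c j ℙ.≟ 1ℙ)) j))
        where
        vanishes : ∀ j → e j ≤ 0ℤ → c j ≡ 0ℙ
        vanishes j e≤0 with c j
        ... | 0ℙ = refl
        ... | 1ℙ with e≤0
        ...   | ℤ.+≤+ ()

      2m≤[s+1]d : + 2 * m ≤ (+ s + 1ℤ) * d
      2m≤[s+1]d = subst₂ _≤_ (sym (sum-*ˡ (+ 2) z)) y-sum (sum-mono 2z≤y)

      0≤m : 0ℤ ≤ m
      0≤m = sum-nonNeg λ p → ind-nonNeg (¬? (y p ℤ.≟ 0ℤ))

      -- The sum of `y` is (s + 1) d > 0, but it is at most (t + 1) m.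
      m≢0 : m ≢ 0ℤ
      m≢0 m≡0 = ℤ.<⇒≱ (*-pos {+ s + 1ℤ} (≢0⇒0<+ λ s+1≡0 → ℕ.1+n≢0 (trans (ℕ.+-comm 1 s) s+1≡0)) 0<d)
        (subst₂ _≤_ y-sum
          (trans (sym (sum-*ˡ (+ t + 1ℤ) z)) (trans (cong ((+ t + 1ℤ) *_) m≡0) (ℤ.*-zeroʳ (+ t + 1ℤ))))
          (sum-mono y≤[t+1]z))

      0<m : 0ℤ < m
      0<m = ℤ.≤∧≢⇒< 0≤m (m≢0 ∘ sym)

      -- For s = 0 a point lies on at most one block, while a point met by the codeword lies on at
      -- least two of its blocks. From s > 0 follow k > 0 and ƛ < k, and then Δ ≥ 0 and b > 0.
      s≢0 : s ≢ 0
      s≢0 s≡0 with sum≢0⇒term≢0 m≢0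
      ... | p , zp≢0 with y-even p | ind≢0 (¬? (y p ℤ.≟ 0ℤ)) zp≢0
      ...   | inj₁ y≡0 | y≢0 = y≢0 y≡0
      ...   | inj₂ 2≤y | y≢0 with sum≢0⇒term≢0 y≢0
      ...     | j , Me≢0 = contradiction (ℤ.≤-trans 2≤y y≤1) λ { (ℤ.+≤+ (ℕ.s≤s ())) }
        where
        p∈j : p ∈ block j
        p∈j = ind≢0 (p ∈? block j) λ M≡0 → Me≢0 (trans (cong (_* e j) M≡0) (ℤ.*-zeroˡ (e j)))
        M≤δ : ∀ i → M p i ≤ δ j i
        M≤δ i with p ∈? block i
        ... | yes p∈i = ℤ.≤-reflexive (sym (ind-true (j ≟ i) (singleton-blocks⇒unique s≡0 p∈j p∈i)))
        ... | no  _   = ind-nonNeg (j ≟ i)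
        y≤1 : y p ≤ 1ℤ
        y≤1 = subst (y p ≤_) (δ-sum j) (sum-mono λ i → ℤ.≤-trans (Me≤M p i) (M≤δ i))

      0<n : 0ℤ < + n
      0<n = Fin⇒0<n (proj₁ (sum≢0⇒term≢0 {f = e} (λ Σe≡0 → 0<⇒≢0 0<d (trans (sym e-sum) Σe≡0))))

      0<v : 0ℤ < + v
      0<v = ≢0⇒0<+ nonEmpty

      0<t+1 : 0ℤ < + t + 1ℤ
      0<t+1 = ≢0⇒0<+ λ t+1≡0 → ℕ.1+n≢0 (trans (ℕ.+-comm 1 t) t+1≡0)

      0<k : 0ℤ < k
      0<k = *-pos (≢0⇒0<+ s≢0) 0<t+1

      ƛ<k : + ƛ ≤ k - 1ℤ
      ƛ<k = 0<k⇒ƛ<k 0<k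

      w = + ƛ - + μ
      Δ = w * w + + 4 * (k - + μ)
      b = + 2 * k - w

      -- This is (k - θ)(k - τ) = μ v for the eigenvalues θ, τ = (w ± √Δ) / 2, since b ∓ √Δ is twice
      -- k - θ, respectively k - τ. The path count `paths` supplies the value.
      gap : b * b - Δ ≡ + 4 * (+ μ * + v)
      gap = trans (expand k w (+ μ)) (trans
        (cong (λ x → + 4 * x - + 4 * (k * w) - + 4 * (k - + μ)) paths)
        (collect k w (+ μ) (+ v)))
        where
        expand : ∀ k w m → (+ 2 * k - w) * (+ 2 * k - w) - (w * w + + 4 * (k - m)) ≡
                 + 4 * (k * k) - + 4 * (k * w) - + 4 * (k - m)
        expand = solve-∀
        collect : ∀ k w m v → + 4 * ((k - m) + w * k + m * v) - + 4 * (k * w) - + 4 * (k - m) ≡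
                  + 4 * (m * v)
        collect = solve-∀

      0<b : 0ℤ < b
      0<b = subst (0ℤ <_) (sym (split k (+ ƛ) (+ μ)))
        (ℤ.+-mono-<-≤ (ℤ.+-mono-<-≤ 0<k (ℤ.i≤j⇒0≤j-i ƛ<k)) (0≤+ {1 ℕ.+ μ}))
        where
        split : ∀ k l m → + 2 * k - (l - m) ≡ k + ((k - 1ℤ) - l) + (1ℤ + m)
        split = solve-∀

      1≤μv : 1ℤ ≤ + μ * + v
      1≤μv = ℤ.i<j⇒suc[i]≤j (*-pos (≢0⇒0<+ μ≢0) 0<v)

      -- Equivalently, -1 lies between the two numbers (w ± √Δ) / 2; the difference of the two sides
      -- is 4 (k - 1 - ƛ).
      [w+2]²≤Δ : (w + + 2) * (w + + 2) ≤ Δ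
      [w+2]²≤Δ = ≤-by (*-nonNeg {+ 4} 0≤+ (ℤ.i≤j⇒0≤j-i ƛ<k)) (certificate k (+ ƛ) (+ μ))
        where
        certificate : ∀ k l m → ((l - m) * (l - m) + + 4 * (k - m)) - (l - m + + 2) * (l - m + + 2) ≡
                      + 4 * ((k - 1ℤ) - l)
        certificate = solve-∀

      spectral : ∀ x → sum x ≡ 0ℤ → let P = x · x ; Z = + 2 * (x · apply A x) - w * P in
                 Z * Z ≤ Δ * (P * P)
      spectral x = spectral-bound A k (+ ƛ) (+ μ) x λ p q →
        trans (sum-cong λ z → cong₂ _*_ (A-sym z p) (A-sym z q)) (A² p q)

      block-gram : ∀ x → apply (λ j p → M p j) x · apply (λ j p → M p j) x ≡
                   (+ t + 1ℤ) * x · x + x · apply A x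
      block-gram x = trans (gram (λ j p → M p j) _ x MMᵀ)
        (trans (form-lin A (+ t + 1ℤ) 1ℤ 0ℤ x)
               (simplify ((+ t + 1ℤ) * x · x) (x · apply A x) (sum x * sum x)))
        where
        simplify : ∀ a b c → a + 1ℤ * b + 0ℤ * c ≡ a + b
        simplify = solve-∀

      e·e : e · e ≡ d
      e·e = trans (sum-cong λ j → ind-idem (c j ℙ.≟ 1ℙ)) e-sum

      2y-sum≤y·y : + 2 * ((+ s + 1ℤ) * d) ≤ y · y
      2y-sum≤y·y = subst (_≤ y · y) (trans (sym (sum-*ˡ (+ 2) y)) (cong (+ 2 *_) y-sum)) (sum-mono 2y≤yy)

      -- The first bound: the centred codeword and its image under M.

      e′ : Fin n → ℤ
      e′ j = + n * e j + - d

      y′ : Fin v → ℤ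
      y′ = apply M e′

      e′-sum : sum e′ ≡ 0ℤ
      e′-sum = trans (affine-sum (+ n) (- d) e) (trans (cong (λ x → + n * x + + n * - d) e-sum) (cancel (+ n) d))
        where
        cancel : ∀ n d → n * d + n * - d ≡ 0ℤ
        cancel = solve-∀

      y′-sum : sum y′ ≡ 0ℤ
      y′-sum = trans (sum-apply M e′ block-sum) (trans (cong ((+ s + 1ℤ) *_) e′-sum) (ℤ.*-zeroʳ (+ s + 1ℤ)))

      e′·e′ : e′ · e′ ≡ + n * d * (+ n - d)
      e′·e′ = trans (affine-· (+ n) (- d) e e (+ n) (- d))
        (trans (cong₂ (λ x σ → + n * + n * x + + n * - d * σ + - d * + n * σ + + n * (- d * - d)) e·e e-sum)
               (simplify (+ n) d))
        where
        simplify : ∀ n d → n * n * d + n * - d * d + - d * n * d + n * (- d * - d) ≡ n * d * (n - d)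
        simplify = solve-∀

      y′·y′ : y′ · y′ ≡ + n * + n * y · y + - (+ 2) * + n * (d * (+ t + 1ℤ)) * ((+ s + 1ℤ) * d) +
                        + v * (+ t + 1ℤ) * (d * d * (+ t + 1ℤ))
      y′·y′ = trans (sum-cong λ p → cong₂ _*_ (entry p) (entry p))
        (trans (affine-· (+ n) f y y (+ n) f)
        (trans (cong (λ σ → + n * + n * y · y + + n * f * σ + f * + n * σ + + v * (f * f)) y-sum)
               (simplify (+ n) d (+ t + 1ℤ) (y · y) ((+ s + 1ℤ) * d) (+ v))))
        where
        f = - d * (+ t + 1ℤ)
        entry : ∀ p → y′ p ≡ + n * y p + f
        entry p = trans (apply-affine M (+ n) (- d) e p) (cong (λ x → + n * y p + - d * x) (point-sum p))
        simplify : ∀ n d t Y σ v →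
          n * n * Y + n * (- d * t) * σ + (- d * t) * n * σ + v * ((- d * t) * (- d * t)) ≡
          n * n * Y + - (+ 2) * n * (d * t) * σ + v * t * (d * d * t)
        simplify = solve-∀

      -- Replacing v (t + 1) by n (s + 1) merges the correction terms of ‖y′‖²; what remains is n²
      -- times ‖y‖² ≥ 2 (s + 1) d.
      y′·y′-bound : + n * d * (+ s + 1ℤ) * (+ 2 * + n - d * (+ t + 1ℤ)) ≤ y′ · y′
      y′·y′-bound = ≤-by (*-nonNeg (square-nonNeg (+ n)) (ℤ.i≤j⇒0≤j-i 2y-sum≤y·y))
        (trans (cong (_- lhs) (trans y′·y′ (cong (λ x →
                 + n * + n * y · y + - (+ 2) * + n * (d * (+ t + 1ℤ)) * ((+ s + 1ℤ) * d) +
                 x * (d * d * (+ t + 1ℤ))) (sym flags))))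
               (certificate (+ n) d (+ s) (+ t) (y · y)))
        where
        lhs = + n * d * (+ s + 1ℤ) * (+ 2 * + n - d * (+ t + 1ℤ))
        certificate : ∀ n d s t Y →
          (n * n * Y + - (+ 2) * n * (d * (t + 1ℤ)) * ((s + 1ℤ) * d) + n * (s + 1ℤ) * (d * d * (t + 1ℤ))) -
          n * d * (s + 1ℤ) * (+ 2 * n - d * (t + 1ℤ)) ≡
          n * n * (Y - + 2 * ((s + 1ℤ) * d))
        certificate = solve-∀

      -- ⟨y′, y′⟩ = ⟨e′, Mᵀ y′⟩.
      y′-cauchy-schwarz : let W = apply (λ j p → M p j) y′ · apply (λ j p → M p j) y′ in
                          (y′ · y′) * (y′ · y′) ≤ (e′ · e′) * W
      y′-cauchy-schwarz = subst (λ x → x * x ≤ (e′ · e′) * (Mᵀy′ · Mᵀy′)) (sym (adjoint M y′ e′))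
        (cauchy-schwarz e′ Mᵀy′)
        where
        Mᵀy′ = apply (λ j p → M p j) y′

      -- The second bound: the points met by the codeword.

      u : Fin n → ℤ
      u = apply (λ j p → M p j) z

      u-nonNeg : ∀ j → 0ℤ ≤ u j
      u-nonNeg j = sum-nonNeg λ p → *-nonNeg (ind-nonNeg (p ∈? block j)) (ind-nonNeg (¬? (y p ℤ.≟ 0ℤ)))

      -- `u j` counts the met points on block `j`, and every point of a block of the codeword is
      -- met.
      u-support : ∀ j → c j ≡ 1ℙ → u j ≡ + s + 1ℤ
      u-support j cj≡1 = trans (sum-cong λ p → by-cases p (p ∈? block j)) (block-sum j)
        where
        1≤y : ∀ {p} → p ∈ block j → 1ℤ ≤ y p
        1≤y {p} p∈j = subst (_≤ y p)
          (cong₂ _*_ (ind-true (p ∈? block j) p∈j) (ind-true (c j ℙ.≟ 1ℙ) cj≡1))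
          (term≤sum (Me-nonNeg p) j)
        by-cases : ∀ p → Dec (p ∈ block j) → M p j * z p ≡ M p j
        by-cases p (yes p∈j) = trans (cong (M p j *_) (ind-true (¬? (y p ℤ.≟ 0ℤ))
          (0<⇒≢0 (ℤ.suc[i]≤j⇒i<j (1≤y p∈j))))) (ℤ.*-identityʳ (M p j))
        by-cases p (no p∉j) = subst (λ x → x * z p ≡ x) (sym (ind-false (p ∈? block j) p∉j)) (ℤ.*-zeroˡ (z p))

      -- On the codeword `u j` = s + 1 and equality holds; elsewhere the claim is u ≤ u² for a
      -- natural number. Summation over `j` bounds ‖u‖² from below.
      u[1+se]≤uu : ∀ j → u j * (1ℤ + + s * e j) ≤ u j * u j
      u[1+se]≤uu j = by-cases (c j ℙ.≟ 1ℙ)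
        where
        off : ∀ u s → u * (1ℤ + s * 0ℤ) ≡ u
        off = solve-∀
        on : ∀ s → 1ℤ + s * 1ℤ ≡ s + 1ℤ
        on = solve-∀
        by-cases : Dec (c j ≡ 1ℙ) → u j * (1ℤ + + s * e j) ≤ u j * u j
        by-cases (yes cj≡1) = ℤ.≤-reflexive (cong (u j *_) (trans
          (cong (λ x → 1ℤ + + s * x) (ind-true (c j ℙ.≟ 1ℙ) cj≡1))
          (trans (on (+ s)) (sym (u-support j cj≡1)))))
        by-cases (no cj≢1) = subst (λ x → u j * (1ℤ + + s * x) ≤ u j * u j)
          (sym (ind-false (c j ℙ.≟ 1ℙ) cj≢1))
          (subst (_≤ u j * u j) (sym (off (u j) (+ s))) (≤-square (u-nonNeg j)))

      -- The part on the codeword is ⟨Mᵀ z , e⟩ = ⟨z , y⟩, which is the sum of `y` because `z` is 1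
      -- wherever `y` is nonzero. Against ‖u‖² = (t + 1) m + ⟨z , A z⟩ this leaves ⟨z , A z⟩ ≥ s (s
      -- + 1) d.
      u·[1+se] : u · (λ j → 1ℤ + + s * e j) ≡ (+ t + 1ℤ) * m + + s * ((+ s + 1ℤ) * d)
      u·[1+se] = trans (sum-cong λ j → expand (u j) (+ s) (e j)) (trans (sum-+ u _)
        (cong₂ _+_ (sum-apply (λ j p → M p j) z point-sum)
          (trans (sym (sum-*ˡ (+ s) _)) (cong (+ s *_)
            (trans (adjoint (λ j p → M p j) e z) (trans (sum-cong zy≡y) y-sum))))))
        where
        expand : ∀ u s e → u * (1ℤ + s * e) ≡ u + s * (u * e)
        expand = solve-∀

      z·z : z · z ≡ m
      z·z = sum-cong λ p → ind-idem (¬? (y p ℤ.≟ 0ℤ))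

      -- Each point met by the codeword lies on at least two of its blocks, whose
      -- other s points are all met as well.
      2sm≤z·Az : + 2 * + s * m ≤ z · apply A z
      2sm≤z·Az = ≤-by
        (+-nonNeg (ℤ.i≤j⇒0≤j-i (sum-mono u[1+se]≤uu)) (*-nonNeg (0≤+ {s}) (ℤ.i≤j⇒0≤j-i 2m≤[s+1]d)))
        (sym (trans (cong₂ (λ x x′ → (x - x′) + + s * ((+ s + 1ℤ) * d - + 2 * m))
                      (trans (block-gram z) (cong (λ x → (+ t + 1ℤ) * x + z · apply A z) z·z)) u·[1+se])
                    (certificate (+ s) (+ t) m d (z · apply A z))))
        where
        certificate : ∀ s t m d R →
          (((t + 1ℤ) * m + R) - ((t + 1ℤ) * m + s * ((s + 1ℤ) * d))) + s * ((s + 1ℤ) * d - + 2 * m) ≡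
          R - + 2 * s * m
        certificate = solve-∀

      z′ : Fin v → ℤ
      z′ p = + v * z p + - m

      z′-sum : sum z′ ≡ 0ℤ
      z′-sum = trans (affine-sum (+ v) (- m) z) (cancel (+ v) m)
        where
        cancel : ∀ v m → v * m + v * - m ≡ 0ℤ
        cancel = solve-∀

      z′·z′ : z′ · z′ ≡ + v * m * (+ v - m)
      z′·z′ = trans (affine-· (+ v) (- m) z z (+ v) (- m))
        (trans (cong (λ x → + v * + v * x + + v * - m * m + - m * + v * m + + v * (- m * - m)) z·z)
               (simplify (+ v) m))
        where
        simplify : ∀ v m → v * v * m + v * - m * m + - m * v * m + v * (- m * - m) ≡ v * m * (v - m)
        simplify = solve-∀

      -- The all-one vector is an eigenvector of the symmetric `A` for the eigenvalue k, so centring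
      -- subtracts just v k m².
      z′·Az′ : z′ · apply A z′ ≡ + v * + v * z · apply A z - + v * k * (m * m)
      z′·Az′ = trans (sum-cong λ p → cong (z′ p *_) (entry p))
        (trans (affine-· (+ v) (- m) z (apply A z) (+ v) (- m * k))
        (trans (cong (λ x → + v * + v * z · apply A z + + v * (- m * k) * m + - m * + v * x + + v * (- m * (- m * k)))
                     (sum-apply A z A-colsum))
               (simplify (+ v) m k (z · apply A z))))
        where
        entry : ∀ p → apply A z′ p ≡ + v * apply A z p + - m * k
        entry p = trans (apply-affine A (+ v) (- m) z p) (cong (λ x → + v * apply A z p + - m * x) (A-sum p))
        simplify : ∀ v m k R →
          v * v * R + v * (- m * k) * m + - m * v * (k * m) + v * (- m * (- m * k)) ≡ v * v * R - v * k * (m * m)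
        simplify = solve-∀

      z′·Az′-bound : + v * m * (+ 2 * + s * + v - k * m) ≤ z′ · apply A z′
      z′·Az′-bound = ≤-by (*-nonNeg (square-nonNeg (+ v)) (ℤ.i≤j⇒0≤j-i 2sm≤z·Az))
        (trans (cong (_- + v * m * (+ 2 * + s * + v - k * m)) z′·Az′)
               (certificate (+ v) m (+ s) k (z · apply A z)))
        where
        certificate : ∀ v m s k R → (v * v * R - v * k * (m * m)) - v * m * (+ 2 * s * v - k * m) ≡
                      v * v * (R - + 2 * s * m)
        certificate = solve-∀

      -- Integer forms of both bounds for an approximation ρ / L.

      module _ {L ρ} (0<L : 0ℤ < L) (0≤ρ : 0ℤ ≤ ρ)
               (ρ²≤ : ρ * ρ ≤ Δ * (L * L)) (≤[ρ+1]² : Δ * (L * L) ≤ (ρ + 1ℤ) * (ρ + 1ℤ)) where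

        private
          0≤L   = ℤ.<⇒≤ 0<L
          0≤ρ+1 : 0ℤ ≤ ρ + 1ℤ
          0≤ρ+1 = +-nonNeg 0≤ρ 0≤+

        denominator-bound : L ≤ b * (b * L - ρ)
        denominator-bound = √-gap {b = b} {Δ = Δ} {μv = + μ * + v} (ℤ.<⇒≤ 0<b) 0≤L gap 1≤μv ρ²≤ 0<L

        bound₁ : + n * ((+ 4 * + s - + 2 * + t + + 2 - w) * L - ρ) ≤ d * (b * L - ρ) + + n
        -- The upper approximation ρ + 1 of L √Δ costs n - d compared with ρ; the summand n on the
        -- right absorbs it.
        bound₁ = ≤-by (+-nonNeg (ℤ.i≤j⇒0≤j-i bits) (ℤ.<⇒≤ 0<d))
          (certificate (+ n) d (+ 4 * + s - + 2 * + t + + 2 - w) b L ρ)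
          where
          bits : (+ n * (+ 4 * + s - + 2 * + t + + 2 - w) - d * b) * L ≤ (+ n - d) * (ρ + 1ℤ)
          bits = bit-bound {s = + s} {w = w} {Δ = Δ} {P = y′ · y′} {R = y′ · apply A y′}
            0<n 0<d 0≤+ 0≤L 0≤ρ+1
            (·-self-nonNeg y′) (·-self-nonNeg e′) y′·y′-bound e′·e′ y′-cauchy-schwarz (block-gram y′)
            (spectral y′ y′-sum) ≤[ρ+1]² [w+2]²≤Δ
          certificate : ∀ n d a b L ρ → (d * (b * L - ρ) + n) - n * (a * L - ρ) ≡
                        ((n - d) * (ρ + 1ℤ) - (n * a - d * b) * L) + d
          certificate = solve-∀

        bound₂ : + 2 * + n * ((+ 4 * + s - w) * L - ρ) ≤ (+ t + 1ℤ) * d * (b * L - ρ) + + 2 * + n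
        bound₂ = parity-bound-weight {v = + v} {n = + n} {d = d} {m = m} {s = + s} {t = + t}
          {a = + 4 * + s - w} {b = b} {ρ = ρ} 0<v (0≤+ {n}) 0≤m flags 2m≤[s+1]d
          (√<b {b = b} {Δ = Δ} {μv = + μ * + v} (ℤ.<⇒≤ 0<b) 0≤L gap 1≤μv ρ²≤)
          (parity-bound {s = + s} {k = k} {w = w} {Δ = Δ} {P = z′ · z′} {R = z′ · apply A z′}
            0<v 0<m 0≤L 0≤ρ+1 (·-self-nonNeg z′)
            z′·Az′-bound z′·z′ (spectral z′ z′-sum) ≤[ρ+1]²)

open Geometry

-- Passage from integer inequalities to limits of rationals.

module Limits where

  open CauchyLemmas using (inv; *-inv; root; isqrt-spec; archimedean; /-mono; *-pos)
  open ℚSolver.+-*-Solver using (solve; _:=_; _:+_; _:-_; _:*_)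

  opaque

    ι : ℤ → ℚ
    ι i = i ℚ./ 1

    frac : ℤ → ℕ → ℚ
    frac i n = i ℚ./ suc n

    private
      toℚᵘ-/ : ∀ i n → ℚ.toℚᵘ (i ℚ./ suc n) ℚᵘ.≃ mkℚᵘ i n
      toℚᵘ-/ i n = ℚ.toℚᵘ-fromℚᵘ (mkℚᵘ i n)

    ι-1 : ι 1ℤ ≡ 1ℚ
    ι-1 = refl

    ι-+ : ∀ i j → ι (i ℤ.+ j) ≡ ι i ℚ.+ ι j
    ι-+ i j = ℚ.toℚᵘ-injective (ℚᵘ.≃-trans (toℚᵘ-/ (i ℤ.+ j) 0) (ℚᵘ.≃-trans (ℚᵘ.*≡* (same i j))
      (ℚᵘ.≃-sym (ℚᵘ.≃-trans (ℚ.toℚᵘ-homo-+ (ι i) (ι j)) (ℚᵘ.+-cong (toℚᵘ-/ i 0) (toℚᵘ-/ j 0))))))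
      where
      same : ∀ i j → (i ℤ.+ j) ℤ.* 1ℤ ≡ (i ℤ.* 1ℤ ℤ.+ j ℤ.* 1ℤ) ℤ.* 1ℤ
      same = solve-∀

    ι-* : ∀ i j → ι (i ℤ.* j) ≡ ι i ℚ.* ι j
    ι-* i j = ℚ.toℚᵘ-injective (ℚᵘ.≃-trans (toℚᵘ-/ (i ℤ.* j) 0)
      (ℚᵘ.≃-sym (ℚᵘ.≃-trans (ℚ.toℚᵘ-homo-* (ι i) (ι j)) (ℚᵘ.*-cong (toℚᵘ-/ i 0) (toℚᵘ-/ j 0)))))

    ι-mono-≤ : ∀ {i j} → i ℤ.≤ j → ι i ℚ.≤ ι j
    ι-mono-≤ {i} {j} i≤j = ℚ.toℚᵘ-cancel-≤ (ℚᵘ.≤-respˡ-≃ (ℚᵘ.≃-sym (toℚᵘ-/ i 0))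
      (ℚᵘ.≤-respʳ-≃ (ℚᵘ.≃-sym (toℚᵘ-/ j 0)) (ℚᵘ.*≤* (ℤ.*-monoʳ-≤-nonNeg 1ℤ i≤j))))

    frac-*-ι : ∀ i n → frac i n ℚ.* ι (+ suc n) ≡ ι i
    frac-*-ι i n = ℚ.toℚᵘ-injective (ℚᵘ.≃-trans (ℚ.toℚᵘ-homo-* (i ℚ./ suc n) (ι (+ suc n)))
      (ℚᵘ.≃-trans (ℚᵘ.*-cong (toℚᵘ-/ i n) (toℚᵘ-/ (+ suc n) 0))
      (ℚᵘ.≃-trans (ℚᵘ.*≡* (trans (same i (+ suc n))
          (cong (λ x → i ℤ.* + x) (sym (ℕ.*-identityʳ (suc n)))))) (ℚᵘ.≃-sym (toℚᵘ-/ i 0)))))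
      where
      same : ∀ i n → (i ℤ.* n) ℤ.* 1ℤ ≡ i ℤ.* n
      same = solve-∀

    frac-small : ∀ {ε} → 0ℚ ℚ.< ε → ∃ λ N → ∀ i → N ℕ.≤ i → frac 1ℤ i ℚ.≤ ε
    frac-small {ε} 0<ε with archimedean ε 0<ε
    ... | N , 1/N≤ε = N , λ i N≤i →
      ℚ.≤-trans (/-mono 1 1 i N (ℕ.*-monoʳ-≤ 1 {suc N} {suc i} (ℕ.s≤s N≤i))) 1/N≤ε

  ι-- : ∀ i j → ι (i ℤ.- j) ≡ ι i ℚ.- ι j
  ι-- i j = trans (cancel (ι (i ℤ.- j)) (ι j)) (cong (ℚ._- ι j)
    (trans (sym (ι-+ (i ℤ.- j) j)) (cong ι (restore i j))))
    where
    cancel : ∀ x y → x ≡ x ℚ.+ y ℚ.- y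
    cancel = solve 2 (λ x y → x := x :+ y :- y) refl
    restore : ∀ i j → i ℤ.- j ℤ.+ j ≡ i
    restore = solve-∀

  ι-pos : ∀ {i} → 0ℤ ℤ.< i → 0ℚ ℚ.< ι i
  ι-pos {i} 0<i = ℚ.<-≤-trans (ℚ.positive⁻¹ 1ℚ)
    (subst (ℚ._≤ ι i) ι-1 (ι-mono-≤ (ℤ.i<j⇒suc[i]≤j 0<i)))

  cancelʳ-≤ : ∀ {x y z} → 0ℚ ℚ.< z → x ℚ.* z ℚ.≤ y ℚ.* z → x ℚ.≤ y
  cancelʳ-≤ {z = z} 0<z = ℚ.*-cancelʳ-≤-pos z {{ℚ.positive 0<z}}

  scaleˡ-≤ : ∀ {x y z} → 0ℚ ℚ.≤ z → x ℚ.≤ y → z ℚ.* x ℚ.≤ z ℚ.* y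
  scaleˡ-≤ {z = z} 0≤z = ℚ.*-monoˡ-≤-nonNeg z {{ℚ.nonNegative 0≤z}}

  <⇒≢0 : ∀ {x} → 0ℚ ℚ.< x → x ≢ 0ℚ
  <⇒≢0 0<x x≡0 = ℚ.<-irrefl (sym x≡0) 0<x

  quotient-≤ : ∀ {x y z} → 0ℚ ℚ.< y → x ℚ.≤ z ℚ.* y → x ℚ.* inv y ℚ.≤ z
  quotient-≤ {x} {y} {z} 0<y h = cancelʳ-≤ 0<y (ℚ.≤-trans (ℚ.≤-reflexive (trans
    (solve 3 (λ x y w → x :* w :* y := x :* (y :* w)) refl x y (inv y))
    (trans (cong (x ℚ.*_) (*-inv (<⇒≢0 0<y))) (ℚ.*-identityʳ x)))) h)

  -- The term of `√ (+ D)` at index `i` is ρ / L with L = i + 1 and ρ the integer part of L √D.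
  module Index (D i : ℕ) where

    L ρ : ℤ
    L = + suc i
    ρ = + root D i

    r 1/L : ℚ
    r   = frac (+ root D i) i
    1/L = frac 1ℤ i

    ιL-pos : 0ℚ ℚ.< ι L
    ιL-pos = ι-pos (ℤ.+<+ (ℕ.s≤s ℕ.z≤n))

    private
      square : + (D ℕ.* (suc i ℕ.* suc i)) ≡ + D ℤ.* (L ℤ.* L)
      square = trans (ℤ.pos-* D (suc i ℕ.* suc i)) (cong (+ D ℤ.*_) (ℤ.pos-* (suc i) (suc i)))

    ρ²≤ : ρ ℤ.* ρ ℤ.≤ + D ℤ.* (L ℤ.* L)
    ρ²≤ = subst₂ ℤ._≤_ (ℤ.pos-* (root D i) (root D i)) square
      (ℤ.+≤+ (proj₁ (isqrt-spec (D ℕ.* (suc i ℕ.* suc i)))))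

    ≤[ρ+1]² : + D ℤ.* (L ℤ.* L) ℤ.≤ (ρ ℤ.+ 1ℤ) ℤ.* (ρ ℤ.+ 1ℤ)
    ≤[ρ+1]² = subst₂ ℤ._≤_ square (trans (ℤ.pos-* (suc (root D i)) (suc (root D i)))
        (cong (λ x → x ℤ.* x) (ℤ.+-comm 1ℤ ρ)))
      (ℤ.+≤+ (ℕ.<⇒≤ (proj₂ (isqrt-spec (D ℕ.* (suc i ℕ.* suc i))))))

    ι-difference : ∀ a → (ι a ℚ.- r) ℚ.* ι L ≡ ι (a ℤ.* L ℤ.- ρ)
    ι-difference a = trans
      (solve 3 (λ a r l → (a :- r) :* l := a :* l :- r :* l) refl (ι a) r (ι L))
      (trans (cong₂ ℚ._-_ (sym (ι-* a L)) (frac-*-ι ρ i)) (sym (ι-- (a ℤ.* L) ρ)))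

    -- Division of the integer inequality by `L` turns the additive `K` into an error K / L that
    -- vanishes in the limit.
    numerator-≤ : ∀ {K G a b} → K ℤ.* (a ℤ.* L ℤ.- ρ) ℤ.≤ G ℤ.* (b ℤ.* L ℤ.- ρ) ℤ.+ K →
                  ι K ℚ.* (ι a ℚ.- r) ℚ.≤ ι G ℚ.* (ι b ℚ.- r) ℚ.+ ι K ℚ.* 1/L
    numerator-≤ {K} {G} {a} {b} h = cancelʳ-≤ ιL-pos (subst₂ ℚ._≤_ (sym lhs) (sym rhs) (ι-mono-≤ h))
      where
      scaled : ∀ K a → ι K ℚ.* (ι a ℚ.- r) ℚ.* ι L ≡ ι (K ℤ.* (a ℤ.* L ℤ.- ρ))
      scaled K a = trans (ℚ.*-assoc (ι K) (ι a ℚ.- r) (ι L))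
        (trans (cong (ι K ℚ.*_) (ι-difference a)) (sym (ι-* K (a ℤ.* L ℤ.- ρ))))
      lhs = scaled K a
      rhs : (ι G ℚ.* (ι b ℚ.- r) ℚ.+ ι K ℚ.* 1/L) ℚ.* ι L ≡ ι (G ℤ.* (b ℤ.* L ℤ.- ρ) ℤ.+ K)
      rhs = trans (ℚ.*-distribʳ-+ (ι L) (ι G ℚ.* (ι b ℚ.- r)) (ι K ℚ.* 1/L))
        (trans (cong₂ ℚ._+_ (scaled G b)
          (trans (ℚ.*-assoc (ι K) 1/L (ι L))
            (trans (cong (ι K ℚ.*_) (trans (frac-*-ι 1ℤ i) ι-1)) (ℚ.*-identityʳ (ι K)))))
          (sym (ι-+ (G ℤ.* (b ℤ.* L ℤ.- ρ)) K)))

    denominator-≥ : ∀ b → L ℤ.≤ + suc b ℤ.* (+ suc b ℤ.* L ℤ.- ρ) →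
                    frac 1ℤ b ℚ.≤ ι (+ suc b) ℚ.- r
    denominator-≥ b h = cancelʳ-≤ ιB-pos (cancelʳ-≤ ιL-pos (subst₂ ℚ._≤_ (sym lhs) (sym rhs) (ι-mono-≤ h)))
      where
      B = + suc b
      ιB-pos = ι-pos {B} (ℤ.+<+ (ℕ.s≤s ℕ.z≤n))
      lhs : (frac 1ℤ b) ℚ.* ι B ℚ.* ι L ≡ ι L
      lhs = trans (cong (ℚ._* ι L) (trans (frac-*-ι 1ℤ b) ι-1)) (ℚ.*-identityˡ (ι L))
      rhs : (ι B ℚ.- r) ℚ.* ι B ℚ.* ι L ≡ ι (B ℤ.* (B ℤ.* L ℤ.- ρ))
      rhs = trans (solve 3 (λ x b l → x :* b :* l := b :* (x :* l)) refl (ι B ℚ.- r) (ι B) (ι L))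
        (trans (cong (ι B ℚ.*_) (ι-difference B)) (sym (ι-* B (B ℤ.* L ℤ.- ρ))))

  -- The target ε η is chosen so that division by a denominator of size at least η leaves an error
  -- of at most ε.
  1/-small : ∀ {K η ε} → 0ℚ ℚ.< K → 0ℚ ℚ.< η → 0ℚ ℚ.< ε →
             ∃ λ N → ∀ i → N ℕ.≤ i → K ℚ.* (frac 1ℤ i) ℚ.≤ ε ℚ.* η
  1/-small {K} {η} {ε} 0<K 0<η 0<ε with frac-small (*-pos (*-pos 0<ε 0<η) 0<invK)
    where
    0<invK : 0ℚ ℚ.< inv K
    0<invK = ℚ.*-cancelˡ-<-nonNeg K {{ℚ.nonNegative (ℚ.<⇒≤ 0<K)}}
      (subst₂ ℚ._<_ (sym (ℚ.*-zeroʳ K)) (sym (*-inv (<⇒≢0 0<K))) (ℚ.positive⁻¹ 1ℚ))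
  ... | N , 1/N≤ = N , λ i N≤i → ℚ.≤-trans
    (scaleˡ-≤ (ℚ.<⇒≤ 0<K) (1/N≤ i N≤i))
    (ℚ.≤-reflexive (trans
      (solve 3 (λ k x w → k :* (x :* w) := x :* (k :* w)) refl K (ε ℚ.* η) (inv K))
      (trans (cong (ε ℚ.* η ℚ.*_) (*-inv (<⇒≢0 0<K))) (ℚ.*-identityʳ (ε ℚ.* η)))))

  term-≤ : ∀ K η ε x y d i → 0ℚ ℚ.< ε → 0ℚ ℚ.< η → η ℚ.≤ y →
           K ℚ.* (frac 1ℤ i) ℚ.≤ ε ℚ.* η →
           x ℚ.≤ d ℚ.* y ℚ.+ K ℚ.* (frac 1ℤ i) → x ℚ.* inv y ℚ.≤ d ℚ.+ ε
  term-≤ K η ε x y d i 0<ε 0<η η≤y K/L≤ h = quotient-≤ (ℚ.<-≤-trans 0<η η≤y)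
    (ℚ.≤-trans h (ℚ.≤-trans
      (ℚ.+-monoʳ-≤ (d ℚ.* y) (ℚ.≤-trans K/L≤ (scaleˡ-≤ (ℚ.<⇒≤ 0<ε) η≤y)))
      (ℚ.≤-reflexive (sym (ℚ.*-distribʳ-+ y d ε)))))

  -- ρ / L ranges over the lower approximations of √Δ
  -- with error at most 1 / L.
  IntegerBounds : (n t d : ℕ) (Δ a₁ a₂ b : ℤ) → Set
  IntegerBounds n t d Δ a₁ a₂ b = ∀ {L ρ} → 0ℤ ℤ.< L → 0ℤ ℤ.≤ ρ →
    ρ ℤ.* ρ ℤ.≤ Δ ℤ.* (L ℤ.* L) → Δ ℤ.* (L ℤ.* L) ℤ.≤ (ρ ℤ.+ 1ℤ) ℤ.* (ρ ℤ.+ 1ℤ) →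
    (+ n ℤ.* (a₁ ℤ.* L ℤ.- ρ) ℤ.≤ + d ℤ.* (b ℤ.* L ℤ.- ρ) ℤ.+ + n) ×
    (+ 2 ℤ.* + n ℤ.* (a₂ ℤ.* L ℤ.- ρ) ℤ.≤ + (t ℕ.+ 1) ℤ.* + d ℤ.* (b ℤ.* L ℤ.- ρ) ℤ.+ + 2 ℤ.* + n) ×
    (L ℤ.≤ b ℤ.* (b ℤ.* L ℤ.- ρ))

  module Approximation {n t d D a₁ a₂ b} (0<n : 0ℤ ℤ.< + n)
                       (bounds : IntegerBounds n t d (+ D) a₁ a₂ (+ suc b)) where

    B = + suc b
    η = frac 1ℤ b

    module _ (i : ℕ) where
      open Index D i public
      private
        all = bounds {L} {ρ} (ℤ.+<+ (ℕ.s≤s ℕ.z≤n)) (ℤ.+≤+ ℕ.z≤n) ρ²≤ ≤[ρ+1]²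

      den₁ : η ℚ.≤ ι B ℚ.- r
      den₁ = denominator-≥ b (proj₂ (proj₂ all))

      num₁ : ι (+ n) ℚ.* (ι a₁ ℚ.- r) ℚ.≤ ι (+ d) ℚ.* (ι B ℚ.- r) ℚ.+ ι (+ n) ℚ.* 1/L
      num₁ = numerator-≤ {+ n} {+ d} {a₁} {B} (proj₁ all)

      num₂ : ι (+ 2) ℚ.* ι (+ n) ℚ.* (ι a₂ ℚ.- r) ℚ.≤
             ι (+ d) ℚ.* (ι (+ (t ℕ.+ 1)) ℚ.* (ι B ℚ.- r)) ℚ.+ ι (+ 2) ℚ.* ι (+ n) ℚ.* 1/L
      num₂ = subst₂ ℚ._≤_
        (cong (ℚ._* (ι a₂ ℚ.- r)) (ι-* (+ 2) (+ n)))
        (cong₂ ℚ._+_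
          (trans (cong (ℚ._* (ι B ℚ.- r)) (ι-* (+ (t ℕ.+ 1)) (+ d)))
            (solve 3 (λ t d x → t :* d :* x := d :* (t :* x)) refl (ι (+ (t ℕ.+ 1))) (ι (+ d)) (ι B ℚ.- r)))
          (cong (ℚ._* 1/L) (ι-* (+ 2) (+ n))))
        (numerator-≤ {+ 2 ℤ.* + n} {+ (t ℕ.+ 1) ℤ.* + d} {a₂} {B} (proj₁ (proj₂ all)))

    0<η : 0ℚ ℚ.< η
    0<η = ℚ.*-cancelʳ-<-nonNeg (ι B) {{ℚ.nonNegative (ℚ.<⇒≤ (ι-pos {B} (ℤ.+<+ (ℕ.s≤s ℕ.z≤n))))}}
      (subst₂ ℚ._<_ (sym (ℚ.*-zeroˡ (ι B))) (sym (trans (frac-*-ι 1ℤ b) ι-1)) (ℚ.positive⁻¹ 1ℚ))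

    den₂ : ∀ i → η ℚ.≤ ι (+ (t ℕ.+ 1)) ℚ.* (ι B ℚ.- r i)
    den₂ i = ℚ.≤-trans (den₁ i) (ℚ.≤-trans (ℚ.≤-reflexive (sym (ℚ.*-identityˡ (ι B ℚ.- r i))))
      (ℚ.*-monoʳ-≤-nonNeg (ι B ℚ.- r i) {{ℚ.nonNegative (ℚ.≤-trans (ℚ.<⇒≤ 0<η) (den₁ i))}}
        (subst (ℚ._≤ ι (+ (t ℕ.+ 1))) ι-1 (ι-mono-≤ (ℤ.+≤+ (ℕ.m≤n+m 1 t))))))

    apart : ∀ {x} → η ℚ.≤ x → η ℚ.≤ ℚ.∣ x ∣
    apart {x} η≤x = subst (η ℚ.≤_) (sym (ℚ.0≤p⇒∣p∣≡p (ℚ.≤-trans (ℚ.<⇒≤ 0<η) η≤x))) η≤x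

    limit : ∀ ε → 0ℚ ℚ.< ε → ∃ λ N → ∀ i → N ℕ.≤ i →
      (ι (+ n) ℚ.* (ι a₁ ℚ.- r i) ℚ.* inv (ι B ℚ.- r i)) ℚ.⊔
      (ι (+ 2) ℚ.* ι (+ n) ℚ.* (ι a₂ ℚ.- r i) ℚ.* inv (ι (+ (t ℕ.+ 1)) ℚ.* (ι B ℚ.- r i))) ℚ.≤ ι (+ d) ℚ.+ ε
    limit ε 0<ε = proj₁ tail₁ ℕ.⊔ proj₁ tail₂ , λ i h → ℚ.⊔-lub
      (term-≤ K₁ η ε (K₁ ℚ.* (ι a₁ ℚ.- r i)) (ι B ℚ.- r i) (ι (+ d)) i 0<ε 0<η (den₁ i)
        (proj₂ tail₁ i (ℕ.m⊔n≤o⇒m≤o (proj₁ tail₁) (proj₁ tail₂) h)) (num₁ i))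
      (term-≤ K₂ η ε (K₂ ℚ.* (ι a₂ ℚ.- r i)) (ι (+ (t ℕ.+ 1)) ℚ.* (ι B ℚ.- r i)) (ι (+ d)) i
        0<ε 0<η (den₂ i)
        (proj₂ tail₂ i (ℕ.m⊔n≤o⇒n≤o (proj₁ tail₁) (proj₁ tail₂) h)) (num₂ i))
      where
      K₁ K₂ : ℚ
      K₁ = ι (+ n)
      K₂ = ι (+ 2) ℚ.* ι (+ n)
      tail₁ = 1/-small {K₁} {η} {ε} (ι-pos 0<n) 0<η 0<ε
      tail₂ = 1/-small {K₂} {η} {ε}
        (*-pos {ι (+ 2)} {ι (+ n)} (ι-pos {+ 2} (ℤ.+<+ (ℕ.s≤s ℕ.z≤n))) (ι-pos 0<n)) 0<η 0<ε

open LinearAlgebra using (square-nonNeg)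
open Limits
open Real

-- The inequality between real numbers.

opaque
  unfolding ι

  -- Matching on Δ lets `√` reduce to its defining sequence, and matching on `b` exposes the lower
  -- bound 1 / b of the denominators. With `ι` unfolded, the rational limit is the order relation of
  -- the reals.
  real-bounds : ∀ n t d Δ a₁ a₂ b → 0ℤ ℤ.≤ Δ → 0ℤ ℤ.< b → 0ℤ ℤ.< + n → IntegerBounds n t d Δ a₁ a₂ b →
    let N₁ = fromℕ n * (fromℤ a₁ - √ Δ)
        D₁ = fromℤ b - √ Δ
        N₂ = fromℕ 2 * fromℕ n * (fromℤ a₂ - √ Δ)
        D₂ = fromℕ (t ℕ.+ 1) * D₁
    in Σ[ D₁#0 ∈ D₁ #0 ] Σ[ D₂#0 ∈ D₂ #0 ]
       N₁ ÷ D₁ [ D₁#0 ] ⊔ N₂ ÷ D₂ [ D₂#0 ] ≤ fromℕ d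
  real-bounds n t d -[1+ _ ] a₁ a₂ b () 0<b 0<n bounds
  real-bounds n t d (+ D) a₁ a₂ -[1+ _ ] 0≤Δ () 0<n bounds
  real-bounds n t d (+ D) a₁ a₂ (+ zero) 0≤Δ (ℤ.+<+ ()) 0<n bounds
  real-bounds n t d (+ D) a₁ a₂ (+ suc b) 0≤Δ 0<b 0<n bounds =
    -- η = 1 / b bounds the first denominator from index 0 on, and also the second, since t + 1 ≥ 1.
    (η , 0<η , 0 , λ i _ → apart (den₁ i)) ,
    (η , 0<η , 0 , λ i _ → apart (den₂ i)) ,
    limit
    where open Approximation {n} {t} {d} {D} {a₁} {a₂} {b} 0<n bounds

theorem4p2 :
    ∀ {v n r} (S : IncidenceStructure v n) (s t : ℕ) (α : Fin r → ℕ) (ƛ μ : ℕ) →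
    IsSRPG S s t α ƛ μ →
    ∀ d → IsMinimumDistance (C (incidenceMatrix S)) d →
    let k  = s ℕ.* (t ℕ.+ 1)
        Δ  = (+ ƛ ℤ.- + μ) ℤ.^ 2 ℤ.+ + 4 ℤ.* (+ k ℤ.- + μ)
        N₁ = fromℕ n * (fromℤ (+ 4 ℤ.* + s ℤ.- + 2 ℤ.* + t ℤ.+ + 2 ℤ.- + ƛ ℤ.+ + μ) - √ Δ)
        D₁ = fromℤ (+ 2 ℤ.* + s ℤ.* (+ t ℤ.+ + 1) ℤ.- + ƛ ℤ.+ + μ) - √ Δ
        N₂ = fromℕ 2 * fromℕ n * (fromℤ (+ 4 ℤ.* + s ℤ.- + ƛ ℤ.+ + μ) - √ Δ)
        D₂ = fromℕ (t ℕ.+ 1) * D₁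
    in Σ[ D₁#0 ∈ D₁ #0 ] Σ[ D₂#0 ∈ D₂ #0 ]
       N₁ ÷ D₁ [ D₁#0 ] ⊔ N₂ ÷ D₂ [ D₂#0 ] ≤ fromℕ d
-- The estimates hold for every nonzero codeword and are applied to one of weight `d`.
theorem4p2 {v} {n} S s t α ƛ μ srpg d ((c , c∈C , c≢0 , refl) , _) =
  real-bounds n t d Δ a₁ a₂ b 0≤Δ (subst (0ℤ ℤ.<_) b≡ W.0<b) W.0<n bounds
  where
  module W = SRPG.Codeword S s t α ƛ μ srpg c c∈C c≢0
  Δ  = (+ ƛ ℤ.- + μ) ℤ.^ 2 ℤ.+ + 4 ℤ.* (+ (s ℕ.* (t ℕ.+ 1)) ℤ.- + μ)
  a₁ = + 4 ℤ.* + s ℤ.- + 2 ℤ.* + t ℤ.+ + 2 ℤ.- + ƛ ℤ.+ + μ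
  a₂ = + 4 ℤ.* + s ℤ.- + ƛ ℤ.+ + μ
  b  = + 2 ℤ.* + s ℤ.* (+ t ℤ.+ + 1) ℤ.- + ƛ ℤ.+ + μ
  Δ≡ : W.Δ ≡ Δ
  Δ≡ = cong₂ (λ x k → x ℤ.+ + 4 ℤ.* (k ℤ.- + μ))
    (cong (W.w ℤ.*_) (sym (ℤ.*-identityʳ W.w))) (sym (ℤ.pos-* s (t ℕ.+ 1)))
  subtract-w : ∀ x l m → x ℤ.- (l ℤ.- m) ≡ x ℤ.- l ℤ.+ m
  subtract-w = solve-∀
  b≡ : W.b ≡ b
  b≡ = assoc (+ s) (+ t ℤ.+ 1ℤ) (+ ƛ) (+ μ)
    where
    assoc : ∀ s t l m → + 2 ℤ.* (s ℤ.* t) ℤ.- (l ℤ.- m) ≡ + 2 ℤ.* s ℤ.* t ℤ.- l ℤ.+ m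
    assoc = solve-∀
  0≤Δ : 0ℤ ℤ.≤ Δ
  0≤Δ = subst (0ℤ ℤ.≤_) Δ≡ (ℤ.≤-trans (square-nonNeg (W.w ℤ.+ + 2)) W.[w+2]²≤Δ)
  bounds : IntegerBounds n t d Δ a₁ a₂ b
  bounds = subst₂ (λ Δ b → IntegerBounds n t d Δ a₁ a₂ b) Δ≡ b≡
    (subst₂ (λ a₁ a₂ → IntegerBounds n t d W.Δ a₁ a₂ W.b)
      (subtract-w (+ 4 ℤ.* + s ℤ.- + 2 ℤ.* + t ℤ.+ + 2) (+ ƛ) (+ μ))
      (subtract-w (+ 4 ℤ.* + s) (+ ƛ) (+ μ))
      (λ {L} {ρ} 0<L 0≤ρ ρ²≤ ≤[ρ+1]² → W.bound₁ {L} {ρ} 0<L 0≤ρ ρ²≤ ≤[ρ+1]² ,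
                                       W.bound₂ {L} {ρ} 0<L 0≤ρ ρ²≤ ≤[ρ+1]² ,
                                       W.denominator-bound {L} {ρ} 0<L 0≤ρ ρ²≤ ≤[ρ+1]²))
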